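{- Let $\mathcal{M}$ be a natural class of matroids. Let $L$ and $N$ be matroids with $E(N)\cap E(L)=\emptyset$, let $p,q$ be distinct elements of $L$, and let $(A,B)$ be a partition of $E(N)$ into two bases of $N$. Suppose that (i) $L$ is an excluded minor for $\mathcal{M}$; (ii) $\{p,q\}$ is an incomparable pair of elements of $L$ such that $L_{p\rightarrow q}$ and $L_{q\rightarrow p}$ are in $\mathcal{M}$; (iii) $N\in\mathcal{M}$. Then every proper minor of $M(L,p,q;N,A,B)$ is in $\mathcal{M}$.
   Context: Freely placing a new element $x$ in a flat $F$ of a matroid $K$ (a principal extension) means forming the matroid $K'$ on $E(K)\cup\{x\}$ with $K'\setminus x=K$ such that a subset of $E(K)$ spans $x$ iff it spans $F$. A class of matroids is natural if it is closed under isomorphism, minors, adding coloops, principal extensions, and direct sums. An excluded minor for $\mathcal{M}$ is a matroid not in $\mathcal{M}$ all of whose proper minors are in $\mathcal{M}$. Distinct elements $p,q$ of $L$ form an incomparable pair if some subset of $E(L)\setminus\{p,q\}$ spans $p$ but not $q$ and some subset spans $q$ but not $p$. For distinct elements $u,v$ of a matroid $K$, $K_{u\rightarrow v}$ is obtained by freely placing a new element $c$ in $\mathrm{cl}_K(\{u,v\})$, deleting $u$, and relabelling $c$ as $u$. Construction: $M_1(L,p,q;N,A,B)$ is obtained from $N\oplus L$ by freely placing new elements $a$ and $b$ in the flats spanned by $E(N)\cup\{p\}$ and $E(N)\cup\{q\}$ respectively, then, for each $x\in A$, freely placing a new element $x_a$ in the flat spanned by $\{x,a\}$, and for each $y\in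 B$, freely placing a new element $y_b$ in the flat spanned by $\{y,b\}$. $M_2(L,p,q;N,A,B)$ is obtained by deleting every $x\in A$, $y\in B$ and relabelling $x_a$ as $x$ and $y_b$ as $y$. $M(L,p,q;N,A,B)=M_2(L,p,q;N,A,B)\setminus\{p,q\}$. -}

module Defs where

open import Data.Nat using (ℕ; zero; suc; _+_; _≤_; _≟_)
open import Data.Fin using (Fin; zero; suc; _↑ˡ_; _↑ʳ_) renaming (_≟_ to _≟ᶠ_)
open import Data.Fin.Properties using (any?)
open import Data.Fin.Subset using (Subset; _∪_; _∩_; ⁅_⁆; ∣_∣; _⊆_; _∈_; _∉_; ∁)
  renaming (⊥ to ∅; ⊤ to full)
open import Data.Fin.Subset.Properties using (_∈?_)
open import Data.Vec using (Vec; []; _∷_; _++_; tabulate; lookup; allFin)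
open import Data.Bool using (Bool; true; false; if_then_else_)
open import Data.Empty using (⊥)
open import Data.Sum using (_⊎_)
open import Data.Product using (Σ; ∃; _×_; _,_)
open import Relation.Nullary using (¬_; does)
open import Relation.Nullary.Decidable using (_×-dec_)
open import Relation.Binary.PropositionalEquality using (_≡_; _≢_)
open import Function.Definitions using (Injective)
open import Function.Bundles using (_⇔_)

record Matroid (n : ℕ) : Set where
  field
    r        : Subset n → ℕ
    r-card   : ∀ X → r X ≤ ∣ X ∣
    r-mono   : ∀ {X Y} → X ⊆ Y → r X ≤ r Y
    r-submod : ∀ X Y → r (X ∪ Y) + r (X ∩ Y) ≤ r X + r Y
open Matroid public

-- A class of matroids (closed under isomorphism is part of "natural").
Class : Set₁
Class = ∀ {n} → Matroid n → Set

module _ {n : ℕ} where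

  Spans : Matroid n → Subset n → Subset n → Set
  Spans M X Y = r M (X ∪ Y) ≡ r M X

  SpansElt : Matroid n → Subset n → Fin n → Set
  SpansElt M X e = Spans M X ⁅ e ⁆

  cl : Matroid n → Subset n → Subset n
  cl M X = tabulate (λ e → does (r M (X ∪ ⁅ e ⁆) ≟ r M X))

  IsFlat : Matroid n → Subset n → Set
  IsFlat M F = ∀ e → SpansElt M F e → e ∈ F

  IsBasis : Matroid n → Subset n → Set
  IsBasis M X = r M X ≡ ∣ X ∣ × r M X ≡ r M full

image : ∀ {k n} → (Fin k → Fin n) → Subset k → Subset n
image f X = tabulate (λ j → does (any? (λ i → (i ∈? X) ×-dec (f i ≟ᶠ j))))

-- Minors (up to isomorphism).  'MinorVia M K C D f' says: C and D are
-- disjoint subsets of E(M), and f : E(K) → E(M) is a bijection onto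
-- E(M) - (C ∪ D) identifying K with M / C \ D, i.e.
-- r_K(X) = r_M(f(X) ∪ C) - r_M(C).

record MinorVia {n k} (M : Matroid n) (K : Matroid k)
                (C D : Subset n) (f : Fin k → Fin n) : Set where
  field
    disjoint : ∀ e → e ∈ C → e ∈ D → ⊥
    f-inj    : Injective _≡_ _≡_ f
    f-avoid  : ∀ i → f i ∉ C × f i ∉ D
    f-onto   : ∀ e → e ∉ C → e ∉ D → ∃ λ i → f i ≡ e
    rank     : ∀ X → r K X + r M C ≡ r M (image f X ∪ C)

Isomorphic : ∀ {n k} → Matroid n → Matroid k → Set
Isomorphic M K = ∃ λ f → MinorVia M K ∅ ∅ f

IsMinor : ∀ {n k} → Matroid n → Matroid k → Set
IsMinor M K = Σ _ λ C → Σ _ λ D → ∃ λ f → MinorVia M K C D f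

IsProperMinor : ∀ {n k} → Matroid n → Matroid k → Set
IsProperMinor M K =
  Σ _ λ C → Σ _ λ D → ∃ λ f → MinorVia M K C D f × ∃ λ e → e ∈ C ⊎ e ∈ D

-- Single-element extensions: the new element is 'zero' of Fin (suc n);
-- an old element e is 'suc e', an old subset X is 'false ∷ X'.

record PrincipalExt {n} (M : Matroid n) (F : Subset n)
                    (M' : Matroid (suc n)) : Set where
  field
    deletion : ∀ X → r M' (false ∷ X) ≡ r M X
    spans    : ∀ X → SpansElt M' (false ∷ X) zero ⇔ Spans M X F

AddColoop : ∀ {n} → Matroid n → Matroid (suc n) → Set
AddColoop M M' = ∀ X → r M' (false ∷ X) ≡ r M X × r M' (true ∷ X) ≡ suc (r M X)

DirectSum : ∀ {n₁ n₂} → Matroid n₁ → Matroid n₂ → Matroid (n₁ + n₂) → Set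
DirectSum M₁ M₂ M = ∀ X Y → r M (X ++ Y) ≡ r M₁ X + r M₂ Y

record Natural (𝓜 : Class) : Set₁ where
  field
    iso-closed   : ∀ {n k} (M : Matroid n) (K : Matroid k) →
                   Isomorphic M K → 𝓜 M → 𝓜 K
    minor-closed : ∀ {n k} (M : Matroid n) (K : Matroid k) →
                   IsMinor M K → 𝓜 M → 𝓜 K
    coloop-closed : ∀ {n} (M : Matroid n) (M' : Matroid (suc n)) →
                   AddColoop M M' → 𝓜 M → 𝓜 M'
    principal-closed : ∀ {n} (M : Matroid n) (F : Subset n) (M' : Matroid (suc n)) →
                   IsFlat M F → PrincipalExt M F M' → 𝓜 M → 𝓜 M'
    sum-closed   : ∀ {n₁ n₂} (M₁ : Matroid n₁) (M₂ : Matroid n₂) (M : Matroid (n₁ + n₂)) →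
                   DirectSum M₁ M₂ M → 𝓜 M₁ → 𝓜 M₂ → 𝓜 M

ExcludedMinor : Class → ∀ {n} → Matroid n → Set
ExcludedMinor 𝓜 L = ¬ 𝓜 L × (∀ {k} (K : Matroid k) → IsProperMinor L K → 𝓜 K)

IncomparablePair : ∀ {l} → Matroid l → Fin l → Fin l → Set
IncomparablePair L p q =
  p ≢ q
  × (∃ λ X → X ⊆ ∁ (⁅ p ⁆ ∪ ⁅ q ⁆) × SpansElt L X p × ¬ SpansElt L X q)
  × (∃ λ Y → Y ⊆ ∁ (⁅ p ⁆ ∪ ⁅ q ⁆) × SpansElt L Y q × ¬ SpansElt L Y p)

redirect : ∀ {l} → Fin l → Fin l → Fin (suc l)
redirect u e = if does (e ≟ᶠ u) then zero else suc e

-- K is K_{u→v}: freely place c in cl{u,v}, delete u, relabel c as u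
Redirected : ∀ {l} → Matroid l → Fin l → Fin l → Matroid l → Set
Redirected L u v K =
  Σ (Matroid (suc _)) λ K' →
    PrincipalExt L (cl L (⁅ u ⁆ ∪ ⁅ v ⁆)) K'
    × MinorVia K' K ∅ ⁅ suc u ⁆ (redirect u)

-- The construction M(L,p,q;N,A,B), with B = ∁ A.
-- Ground set of N ⊕ L is Fin (m + l): N-element i is i ↑ˡ l,
-- L-element p is m ↑ʳ p.  Then a is added (new 'zero'), then b
-- (new 'zero', a becomes 'suc zero'); the stage-2 matroid lives on
-- Fin (2 + (m + l)).  Then the copies x_a / y_b of the elements of N
-- are added one at a time; after k of them the matroid lives on
-- Fin (k + (2 + (m + l))) and old elements are shifted by k ↑ʳ_.

module _ {m l : ℕ} where

  elemsN : Subset (m + l)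
  elemsN = full {m} ++ ∅ {l}

  posL : Fin l → Fin (m + l)
  posL p = m ↑ʳ p

  pos2N : Fin m → Fin (2 + (m + l))
  pos2N x = suc (suc (x ↑ˡ l))

  pos2a pos2b : Fin (2 + (m + l))
  pos2a = suc zero
  pos2b = zero

  partner : Subset m → Fin m → Fin (2 + (m + l))
  partner A x = if lookup A x then pos2a else pos2b

  -- Copies A S2 xs K: K arises from S2 by freely placing, for each x in xs
  -- (last entry first), a new element x_a in cl{x,a} (x ∈ A) or
  -- x_b in cl{x,b} (x ∉ A), in the current matroid.
  data Copies (A : Subset m) (S2 : Matroid (2 + (m + l))) :
       ∀ {k} → Vec (Fin m) k → Matroid (k + (2 + (m + l))) → Set where
    done : Copies A S2 [] S2
    step : ∀ {k} {xs : Vec (Fin m) k} {K : Matroid (k + (2 + (m + l)))}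
             {K' : Matroid (suc (k + (2 + (m + l))))} (x : Fin m) →
           Copies A S2 xs K →
           PrincipalExt K (cl K (⁅ k ↑ʳ pos2N x ⁆ ∪ ⁅ k ↑ʳ partner A x ⁆)) K' →
           Copies A S2 (x ∷ xs) K'

  -- elements of M₁ deleted to obtain M: the original elements of N
  -- (deleted and replaced by their copies in M₂) together with p and q.
  deleted : Fin l → Fin l → Subset (m + (2 + (m + l)))
  deleted p q = ∅ {m} ++ (false ∷ false ∷ (elemsN ∪ ⁅ posL p ⁆ ∪ ⁅ posL q ⁆))

  -- M is (isomorphic to) M(L,p,q;N,A,∁A) = M₂ \ {p,q}
  --   ≅ M₁ \ (A ∪ B ∪ {p,q}).
  record IsM (L : Matroid l) (p q : Fin l) (N : Matroid m) (A : Subset m)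
             {k} (M : Matroid k) : Set where
    field
      S0   : Matroid (m + l)
      S1   : Matroid (suc (m + l))
      S2   : Matroid (2 + (m + l))
      M₁   : Matroid (m + (2 + (m + l)))
      sum  : DirectSum N L S0
      addA : PrincipalExt S0 (cl S0 (elemsN ∪ ⁅ posL p ⁆)) S1
      addB : PrincipalExt S1 (cl S1 (false ∷ (elemsN ∪ ⁅ posL q ⁆))) S2
      copies : Copies A S2 (allFin m) M₁
      relabel : Fin k → Fin (m + (2 + (m + l)))
      isDel  : MinorVia M₁ M ∅ (deleted p q) relabel

{-# OPTIONS --safe #-}
module Submission where

-- Consider a set consisting of X ⊆ E(L), of copies of a set U ⊆ E(N), and possibly of a and b, with s elements
-- in A ∪ {a} and t elements in B ∪ {b}. Its rank in the construction is the minimum of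
--   r_L(X) + s + t,   r_L(X) + r_N(U) + 2,   r(N) + r_L(X ∪ p) + [t > 0],
--   r(N) + r_L(X ∪ q) + [s > 0],   r(N) + r_L(X ∪ {p, q}).
-- If an element of A ∪ {a} is deleted, then s ≤ r(N), and if one is contracted, then s > 0; the formula shows
-- that in the first case L may be replaced by L_{p→q}, and in the second case by L_{q→p}, without changing
-- the minor. The same holds for B ∪ {b} with p and q exchanged, and for an element of L one replaces L by its
-- one-element minor. In each case the construction is made from members of the class by direct sums and
-- principal extensions.

-- The construction over `L` has `L` as a minor and so lies outside the class; a proper minor is
-- therefore recognised inside the construction over another matroid. The replacement keeps the
-- ground set, `p`, `q`, `N` and `A`, so the same contracted set, deleted set and embedding describe
-- the minor. Ranks need to agree, up to one additive constant, only on sets that contain all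
-- contracted elements and avoid all deleted ones. Such sets avoid `p` and `q`, which matter only
-- through the flats of `a` and `b`. Copies are added one at a time, so a rank is a nested minimum
-- over the choices of a set `W` of copies that are traded for the generators of their flats, every
-- other copy counting one. Where neither `p` nor `q` enters, a `W` inside one of the two bases is
-- independent and gives nothing below the first term; a `W` meeting both bases brings in both `a`
-- and `b`, the origin of the constant 2. This is why only five terms survive. The bound `s ≤ r(N)`
-- holds because `A ∪ {a}` has just one element more than a basis.

open import Defs
open import Data.Bool using (Bool; true; false; if_then_else_; _∨_; _∧_; not)
open import Data.Bool.Properties using (∨-identityʳ; ∨-zeroʳ)
open import Data.Empty using (⊥; ⊥-elim)
open import Data.Fin using (Fin; zero; suc; _↑ˡ_; _↑ʳ_; punchIn; punchOut; splitAt)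
open import Data.Fin.Properties using (any?; join-splitAt; punchIn-injective; punchInᵢ≢i; punchIn-punchOut; punchOut-punchIn; punchOut-cong) renaming (_≟_ to _≟ᶠ_)
open import Data.Fin.Subset using (Subset; _∪_; _∩_; ⁅_⁆; ∣_∣; _⊆_; _∈_; _∉_; ∁) renaming (⊥ to ∅; ⊤ to full)
open import Data.Fin.Subset.Properties
open import Data.Nat using (ℕ; zero; suc; _+_; _∸_; _⊓_; _≤_; z≤n; s≤s; _≟_)
open import Data.Nat.Properties hiding (_≟_)
open import Data.Nat.Solver using (module +-*-Solver)
open import Data.Product using (Σ; ∃; ∃₂; _×_; _,_; proj₁; proj₂)
open import Data.Sum using (_⊎_; inj₁; inj₂; [_,_]′)
open import Data.Vec using (Vec; []; _∷_; _++_; lookup; allFin; take; drop; here; there)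
open import Data.Vec.Properties using (zipWith-++; lookup-allFin; lookup∘tabulate; []=⇒lookup; lookup⇒[]=; take++drop≡id; take-zipWith; drop-zipWith; lookup-map; ++-injectiveˡ; ++-injectiveʳ)
open import Function using (_∘_)
open import Function.Bundles using (mk⇔; Equivalence)
open import Function.Definitions using (Injective)
open import Relation.Binary.PropositionalEquality using (_≡_; _≢_; refl; sym; trans; cong; cong₂; subst; module ≡-Reasoning)
open import Relation.Nullary using (Dec; yes; no; does; contradiction)
open import Relation.Nullary.Decidable using (_×-dec_; dec-true)

open +-*-Solver using (solve; _:+_; _:=_; con)

-- Subsets of Fin n

∪-lub : ∀ {n} {X Y Z : Subset n} → X ⊆ Z → Y ⊆ Z → X ∪ Y ⊆ Z
∪-lub {X = X} {Y} X⊆Z Y⊆Z e∈ with x∈p∪q⁻ X Y e∈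
... | inj₁ e∈X = X⊆Z e∈X
... | inj₂ e∈Y = Y⊆Z e∈Y

⊆-∪ˡ : ∀ {n} {X Y : Subset n} (Z : Subset n) → X ⊆ Y → X ⊆ Y ∪ Z
⊆-∪ˡ Z X⊆Y e∈X = p⊆p∪q Z (X⊆Y e∈X)

⊆-∪ʳ : ∀ {n} {X Z : Subset n} (Y : Subset n) → X ⊆ Z → X ⊆ Y ∪ Z
⊆-∪ʳ {Z = Z} Y X⊆Z e∈X = q⊆p∪q Y Z (X⊆Z e∈X)

∪-monoˡ-⊆ : ∀ {n} {X Y : Subset n} (Z : Subset n) → X ⊆ Y → X ∪ Z ⊆ Y ∪ Z
∪-monoˡ-⊆ {X = X} {Y} Z X⊆Y = ∪-lub {X = X} {Z} (⊆-∪ˡ {X = X} Z X⊆Y) (q⊆p∪q Y Z)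

⁅⁆⊆ : ∀ {n} {e : Fin n} {X : Subset n} → e ∈ X → ⁅ e ⁆ ⊆ X
⁅⁆⊆ {e = e} {X} e∈X x∈ = subst (_∈ X) (sym (x∈⁅y⁆⇒x≡y e x∈)) e∈X

∉-∪⁅⁆ : ∀ {n} {e f : Fin n} {X : Subset n} → e ∉ X → e ≢ f → e ∉ X ∪ ⁅ f ⁆
∉-∪⁅⁆ {f = f} {X} e∉X e≢f e∈ with x∈p∪q⁻ X ⁅ f ⁆ e∈
... | inj₁ e∈X = e∉X e∈X
... | inj₂ e∈f = e≢f (x∈⁅y⁆⇒x≡y f e∈f)

∪-swapʳ : ∀ {n} (X Y Z : Subset n) → (X ∪ Y) ∪ Z ≡ (X ∪ Z) ∪ Y
∪-swapʳ X Y Z = trans (∪-assoc X Y Z) (trans (cong (X ∪_) (∪-comm Y Z)) (sym (∪-assoc X Z Y)))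

∣X∪Y∣≤∣X∣+∣Y∣ : ∀ {n} (X Y : Subset n) → ∣ X ∪ Y ∣ ≤ ∣ X ∣ + ∣ Y ∣
∣X∪Y∣≤∣X∣+∣Y∣ []          []          = z≤n
∣X∪Y∣≤∣X∣+∣Y∣ (false ∷ X) (false ∷ Y) = ∣X∪Y∣≤∣X∣+∣Y∣ X Y
∣X∪Y∣≤∣X∣+∣Y∣ (false ∷ X) (true ∷ Y)  = ≤-trans (s≤s (∣X∪Y∣≤∣X∣+∣Y∣ X Y)) (≤-reflexive (sym (+-suc ∣ X ∣ ∣ Y ∣)))
∣X∪Y∣≤∣X∣+∣Y∣ (true ∷ X)  (false ∷ Y) = s≤s (∣X∪Y∣≤∣X∣+∣Y∣ X Y)
∣X∪Y∣≤∣X∣+∣Y∣ (true ∷ X)  (true ∷ Y)  =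
  s≤s (≤-trans (∣X∪Y∣≤∣X∣+∣Y∣ X Y) (+-monoʳ-≤ ∣ X ∣ (n≤1+n ∣ Y ∣)))

∣X∩Y∣+∣X∩∁Y∣≡∣X∣ : ∀ {n} (X Y : Subset n) → ∣ X ∩ Y ∣ + ∣ X ∩ ∁ Y ∣ ≡ ∣ X ∣
∣X∩Y∣+∣X∩∁Y∣≡∣X∣ []          []          = refl
∣X∩Y∣+∣X∩∁Y∣≡∣X∣ (false ∷ X) (_ ∷ Y)     = ∣X∩Y∣+∣X∩∁Y∣≡∣X∣ X Y
∣X∩Y∣+∣X∩∁Y∣≡∣X∣ (true ∷ X)  (true ∷ Y)  = cong suc (∣X∩Y∣+∣X∩∁Y∣≡∣X∣ X Y)
∣X∩Y∣+∣X∩∁Y∣≡∣X∣ (true ∷ X)  (false ∷ Y) =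
  trans (+-suc ∣ X ∩ Y ∣ ∣ X ∩ ∁ Y ∣) (cong suc (∣X∩Y∣+∣X∩∁Y∣≡∣X∣ X Y))

∣++∣ : ∀ {n₁ n₂} (X : Subset n₁) (Y : Subset n₂) → ∣ X ++ Y ∣ ≡ ∣ X ∣ + ∣ Y ∣
∣++∣ []          Y = refl
∣++∣ (false ∷ X) Y = ∣++∣ X Y
∣++∣ (true ∷ X)  Y = cong suc (∣++∣ X Y)

∈⇒1≤∣∣ : ∀ {n} {e : Fin n} {X : Subset n} → e ∈ X → 1 ≤ ∣ X ∣
∈⇒1≤∣∣ {e = e} {X} e∈X = ≤-trans (≤-reflexive (sym (∣⁅x⁆∣≡1 e))) (p⊆q⇒∣p∣≤∣q∣ (⁅⁆⊆ e∈X))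

subset-ind : ∀ {n} (Q : Subset n → Set) → Q ∅ → (∀ {X Y} → Q X → Q Y → Q (X ∪ Y)) →
             ∀ X → (∀ {e} → e ∈ X → Q ⁅ e ⁆) → Q X
subset-ind Q q∅ q∪ []          q⁅⁆ = q∅
subset-ind Q q∅ q∪ (false ∷ X) q⁅⁆ = subset-ind (Q ∘ (false ∷_)) q∅ q∪ X (q⁅⁆ ∘ there)
subset-ind Q q∅ q∪ (true ∷ X)  q⁅⁆ = subst (λ Y → Q (true ∷ Y)) (∪-identityˡ X)
  (q∪ (q⁅⁆ here) (subset-ind (Q ∘ (false ∷_)) q∅ q∪ X (q⁅⁆ ∘ there)))

++-∪ : ∀ {n₁ n₂} (X X' : Subset n₁) (Y Y' : Subset n₂) → (X ++ Y) ∪ (X' ++ Y') ≡ (X ∪ X') ++ (Y ∪ Y')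
++-∪ X X' Y Y' = zipWith-++ _∨_ X Y X' Y'

∅++∅ : ∀ n₁ {n₂} → ∅ {n₁} ++ ∅ {n₂} ≡ ∅ {n₁ + n₂}
∅++∅ zero     = refl
∅++∅ (suc n₁) = cong (false ∷_) (∅++∅ n₁)

⁅↑ˡ⁆ : ∀ {n₁} n₂ (i : Fin n₁) → ⁅ i ↑ˡ n₂ ⁆ ≡ ⁅ i ⁆ ++ ∅ {n₂}
⁅↑ˡ⁆ {suc n₁} n₂ zero = cong (true ∷_) (sym (∅++∅ n₁))
⁅↑ˡ⁆ n₂ (suc i)       = cong (false ∷_) (⁅↑ˡ⁆ n₂ i)

⁅↑ʳ⁆ : ∀ n₁ {n₂} (i : Fin n₂) → ⁅ n₁ ↑ʳ i ⁆ ≡ ∅ {n₁} ++ ⁅ i ⁆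
⁅↑ʳ⁆ zero i     = refl
⁅↑ʳ⁆ (suc n₁) i = cong (false ∷_) (⁅↑ʳ⁆ n₁ i)

∈-++⁺ˡ : ∀ {n₁ n₂} {X : Subset n₁} {Y : Subset n₂} {i} → i ∈ X → i ↑ˡ n₂ ∈ X ++ Y
∈-++⁺ˡ here        = here
∈-++⁺ˡ (there i∈X) = there (∈-++⁺ˡ i∈X)

∈-++⁻ˡ : ∀ {n₁ n₂} {X : Subset n₁} {Y : Subset n₂} i → i ↑ˡ n₂ ∈ X ++ Y → i ∈ X
∈-++⁻ˡ {X = _ ∷ _} zero    here       = here
∈-++⁻ˡ {X = _ ∷ _} (suc i) (there i∈) = there (∈-++⁻ˡ i i∈)

∈-++⁺ʳ : ∀ {n₁ n₂} (X : Subset n₁) {Y : Subset n₂} {i} → i ∈ Y → n₁ ↑ʳ i ∈ X ++ Y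
∈-++⁺ʳ []      i∈Y = i∈Y
∈-++⁺ʳ (_ ∷ X) i∈Y = there (∈-++⁺ʳ X i∈Y)

∈-++⁻ʳ : ∀ {n₁ n₂} (X : Subset n₁) {Y : Subset n₂} {i} → n₁ ↑ʳ i ∈ X ++ Y → i ∈ Y
∈-++⁻ʳ []      i∈         = i∈
∈-++⁻ʳ (_ ∷ X) (there i∈) = ∈-++⁻ʳ X i∈

does-true : ∀ {P : Set} (d : Dec P) → does d ≡ true → P
does-true (yes p) _ = p

∈-image⁺ : ∀ {k n} (f : Fin k → Fin n) {X i} → i ∈ X → f i ∈ image f X
∈-image⁺ f {X} {i} i∈X = lookup⇒[]= (f i) (image f X)
  (trans (lookup∘tabulate _ (f i)) (dec-true (any? (λ j → (j ∈? X) ×-dec (f j ≟ᶠ f i))) (i , i∈X , refl)))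

∈-image⁻ : ∀ {k n} (f : Fin k → Fin n) X {e} → e ∈ image f X → ∃ λ i → i ∈ X × f i ≡ e
∈-image⁻ f X {e} e∈ = does-true (any? (λ j → (j ∈? X) ×-dec (f j ≟ᶠ e))) (trans (sym (lookup∘tabulate _ e)) ([]=⇒lookup e∈))

image-mono : ∀ {k n} (f : Fin k → Fin n) {X Y} → X ⊆ Y → image f X ⊆ image f Y
image-mono f {X} {Y} X⊆Y e∈ with ∈-image⁻ f X e∈
... | i , i∈X , refl = ∈-image⁺ f (X⊆Y i∈X)

image-∪ : ∀ {k n} (f : Fin k → Fin n) X Y → image f (X ∪ Y) ≡ image f X ∪ image f Y
image-∪ f X Y = ⊆-antisym ⇒ (∪-lub {X = image f X} (image-mono f (p⊆p∪q Y)) (image-mono f (q⊆p∪q X Y)))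
  where
  ⇒ : image f (X ∪ Y) ⊆ image f X ∪ image f Y
  ⇒ e∈ with ∈-image⁻ f (X ∪ Y) e∈
  ... | i , i∈ , refl with x∈p∪q⁻ X Y i∈
  ... | inj₁ i∈X = p⊆p∪q _ (∈-image⁺ f i∈X)
  ... | inj₂ i∈Y = q⊆p∪q _ _ (∈-image⁺ f i∈Y)

image-∘ : ∀ {j k n} (g : Fin k → Fin n) (f : Fin j → Fin k) X → image (g ∘ f) X ≡ image g (image f X)
image-∘ g f X = ⊆-antisym ⇒ ⇐
  where
  ⇒ : image (g ∘ f) X ⊆ image g (image f X)
  ⇒ e∈ with ∈-image⁻ (g ∘ f) X e∈
  ... | i , i∈X , refl = ∈-image⁺ g (∈-image⁺ f i∈X)
  ⇐ : image g (image f X) ⊆ image (g ∘ f) X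
  ⇐ e∈ with ∈-image⁻ g (image f X) e∈
  ... | i , i∈ , refl with ∈-image⁻ f X i∈
  ... | h , h∈X , refl = ∈-image⁺ (g ∘ f) h∈X

∣image∣≤ : ∀ {k n} (f : Fin k → Fin n) X → ∣ image f X ∣ ≤ ∣ X ∣
∣image∣≤ {n = n} f [] = ≤-trans (p⊆q⇒∣p∣≤∣q∣ ⇒) (≤-reflexive (∣⊥∣≡0 n))
  where
  ⇒ : image f [] ⊆ ∅
  ⇒ e∈ with ∈-image⁻ f [] e∈
  ... | () , _
∣image∣≤ f (x ∷ X) = go x
  where
  rest : ∣ image (f ∘ suc) X ∣ ≤ ∣ X ∣
  rest = ∣image∣≤ (f ∘ suc) X
  go : ∀ x → ∣ image f (x ∷ X) ∣ ≤ ∣ x ∷ X ∣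
  go false = ≤-trans (p⊆q⇒∣p∣≤∣q∣ ⇒') rest
    where
    ⇒' : image f (false ∷ X) ⊆ image (f ∘ suc) X
    ⇒' e∈ with ∈-image⁻ f (false ∷ X) e∈
    ... | suc i , there i∈X , refl = ∈-image⁺ (f ∘ suc) i∈X
  go true = ≤-trans (p⊆q⇒∣p∣≤∣q∣ ⇒')
      (≤-trans (∣X∪Y∣≤∣X∣+∣Y∣ ⁅ f zero ⁆ _) (+-mono-≤ (≤-reflexive (∣⁅x⁆∣≡1 (f zero))) rest))
    where
    ⇒' : image f (true ∷ X) ⊆ ⁅ f zero ⁆ ∪ image (f ∘ suc) X
    ⇒' e∈ with ∈-image⁻ f (true ∷ X) e∈
    ... | zero  , here , refl       = p⊆p∪q _ (x∈⁅x⁆ (f zero))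
    ... | suc i , there i∈X , refl = q⊆p∪q ⁅ f zero ⁆ _ (∈-image⁺ (f ∘ suc) i∈X)

-- Rank and closure

module _ {n} (M : Matroid n) where

  r-∅ : r M ∅ ≡ 0
  r-∅ = n≤0⇒n≡0 (≤-trans (r-card M ∅) (≤-reflexive (∣⊥∣≡0 n)))

  r-∪-card : ∀ X Y → r M (X ∪ Y) ≤ r M X + ∣ Y ∣
  r-∪-card X Y = ≤-trans (m≤m+n _ _) (≤-trans (r-submod M X Y) (+-monoʳ-≤ (r M X) (r-card M Y)))

  r-∪⁅⁆ : ∀ X e → r M (X ∪ ⁅ e ⁆) ≤ suc (r M X)
  r-∪⁅⁆ X e = ≤-trans (r-∪-card X ⁅ e ⁆) (≤-reflexive (trans (cong (r M X +_) (∣⁅x⁆∣≡1 e)) (+-comm (r M X) 1)))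

  r-≤∪ : ∀ X Y → r M X ≤ r M (X ∪ Y)
  r-≤∪ X Y = r-mono M (p⊆p∪q Y)

  -- Submodularity for `G ∪ Y` and `G ∪ Z`, whose intersection contains `G`.
  spans-∪ : ∀ {G Y Z} → Spans M G Y → Spans M G Z → Spans M G (Y ∪ Z)
  spans-∪ {G} {Y} {Z} sY sZ = ≤-antisym (+-cancelʳ-≤ (r M G) _ _ bound) (r-≤∪ G _)
    where
    open ≤-Reasoning
    G∪Y = G ∪ Y
    G∪Z = G ∪ Z
    bound : r M (G ∪ (Y ∪ Z)) + r M G ≤ r M G + r M G
    bound = begin
      r M (G ∪ (Y ∪ Z)) + r M G             ≤⟨ +-mono-≤ (r-mono M (∪-lub {X = G} (⊆-∪ˡ {X = G} G∪Z (p⊆p∪q Y)) (∪-lub {X = Y} (⊆-∪ˡ {X = Y} G∪Z (q⊆p∪q G Y)) (⊆-∪ʳ {X = Z} G∪Y (q⊆p∪q G Z)))))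
                                                  (r-mono M (λ e∈ → x∈p∩q⁺ (p⊆p∪q Y e∈ , p⊆p∪q Z e∈))) ⟩
      r M (G∪Y ∪ G∪Z) + r M (G∪Y ∩ G∪Z)     ≤⟨ r-submod M G∪Y G∪Z ⟩
      r M G∪Y + r M G∪Z                     ≡⟨ cong₂ _+_ sY sZ ⟩
      r M G + r M G                         ∎

  spans-pointwise : ∀ {G} Y → (∀ {e} → e ∈ Y → SpansElt M G e) → Spans M G Y
  spans-pointwise {G} Y = subset-ind (Spans M G) (cong (r M) (∪-identityʳ G)) spans-∪ Y

  spans-mono : ∀ {X G Y} → X ⊆ G → Spans M X Y → Spans M G Y
  spans-mono {X} {G} {Y} X⊆G s = ≤-antisym (+-cancelʳ-≤ (r M X) _ _ bound) (r-≤∪ G _)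
    where
    open ≤-Reasoning
    bound : r M (G ∪ Y) + r M X ≤ r M G + r M X
    bound = begin
      r M (G ∪ Y) + r M X                       ≤⟨ +-mono-≤ (r-mono M (∪-lub {X = G} (p⊆p∪q _) (⊆-∪ʳ {X = Y} G (q⊆p∪q X Y))))
                                                      (r-mono M (λ e∈ → x∈p∩q⁺ (X⊆G e∈ , p⊆p∪q Y e∈))) ⟩
      r M (G ∪ (X ∪ Y)) + r M (G ∩ (X ∪ Y))     ≤⟨ r-submod M G (X ∪ Y) ⟩
      r M G + r M (X ∪ Y)                       ≡⟨ cong (r M G +_) s ⟩
      r M G + r M X                             ∎

  ∈-cl⁻ : ∀ {G e} → e ∈ cl M G → SpansElt M G e
  ∈-cl⁻ {G} {e} e∈ = does-true (r M (G ∪ ⁅ e ⁆) ≟ r M G) (trans (sym (lookup∘tabulate _ e)) ([]=⇒lookup e∈))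

  ∈-cl⁺ : ∀ {G e} → SpansElt M G e → e ∈ cl M G
  ∈-cl⁺ {G} {e} s = lookup⇒[]= e (cl M G) (trans (lookup∘tabulate _ e) (dec-true (r M (G ∪ ⁅ e ⁆) ≟ r M G) s))

  ⊆-cl : ∀ G → G ⊆ cl M G
  ⊆-cl G e∈G = ∈-cl⁺ (cong (r M) (⊆-antisym (∪-lub {X = G} ⊆-refl (⁅⁆⊆ e∈G)) (p⊆p∪q _)))

  -- The construction places elements in closures of explicit sets; with this, ranks are computed
  -- from the generators alone.
  r-∪-cl : ∀ X G → r M (X ∪ cl M G) ≡ r M (X ∪ G)
  r-∪-cl X G = ≤-antisym
    (≤-trans (r-mono M (∪-lub {X = X} (⊆-∪ˡ {X = X} (cl M G) (p⊆p∪q G)) (q⊆p∪q (X ∪ G) _)))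
             (≤-reflexive (spans-mono (q⊆p∪q X G) (spans-pointwise (cl M G) ∈-cl⁻))))
    (r-mono M (∪-lub {X = X} (p⊆p∪q _) (⊆-∪ʳ {X = G} X (⊆-cl G))))

  cl-flat : ∀ G → IsFlat M (cl M G)
  cl-flat G e s = ∈-cl⁺ (≤-antisym
    (≤-trans (r-mono M (∪-monoˡ-⊆ ⁅ e ⁆ (⊆-cl G)))
      (≤-reflexive (trans s (trans (cong (r M) (sym (∪-idem (cl M G)))) (trans (r-∪-cl (cl M G) G)
        (trans (cong (r M) (∪-comm (cl M G) G)) (trans (r-∪-cl G G) (cong (r M) (∪-idem G)))))))))
    (r-≤∪ G _))

  -- `B` is covered by `W` and `B ∩ ∁ W`, so a rank deficit of `W` would carry over to `B`.
  basis-indep : ∀ {B W} → IsBasis M B → W ⊆ B → r M W ≡ ∣ W ∣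
  basis-indep {B} {W} (rB≡∣B∣ , _) W⊆B = ≤-antisym (r-card M W) (+-cancelʳ-≤ ∣ B ∩ ∁ W ∣ _ _ bound)
    where
    open ≤-Reasoning
    B⊆ : B ⊆ W ∪ (B ∩ ∁ W)
    B⊆ {e} e∈B with e ∈? W
    ... | yes e∈W = p⊆p∪q _ e∈W
    ... | no e∉W  = q⊆p∪q W _ (x∈p∩q⁺ (e∈B , x∉p⇒x∈∁p e∉W))
    bound : ∣ W ∣ + ∣ B ∩ ∁ W ∣ ≤ r M W + ∣ B ∩ ∁ W ∣
    bound = begin
      ∣ W ∣ + ∣ B ∩ ∁ W ∣      ≤⟨ +-monoˡ-≤ _ (p⊆q⇒∣p∣≤∣q∣ (λ e∈ → x∈p∩q⁺ (W⊆B e∈ , e∈))) ⟩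
      ∣ B ∩ W ∣ + ∣ B ∩ ∁ W ∣  ≡⟨ ∣X∩Y∣+∣X∩∁Y∣≡∣X∣ B W ⟩
      ∣ B ∣                    ≡⟨ rB≡∣B∣ ⟨
      r M B                    ≤⟨ r-mono M B⊆ ⟩
      r M (W ∪ (B ∩ ∁ W))      ≤⟨ r-∪-card W _ ⟩
      r M W + ∣ B ∩ ∁ W ∣      ∎

-- Principal extensions

module _ {n} {M : Matroid n} {M' : Matroid (suc n)} where

  -- `PrincipalExt` prescribes only when the new element is spanned. Since one element raises a rank
  -- by at most one, this already determines the whole rank function.
  principal-rank : ∀ {F} → PrincipalExt M F M' → ∀ X → r M' (true ∷ X) ≡ suc (r M X) ⊓ r M (X ∪ F)
  principal-rank {F} E X with r M (X ∪ F) ≟ r M X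
  ... | yes sp = trans (subst (λ Y → r M' (true ∷ Y) ≡ r M' (false ∷ X)) (∪-identityʳ X) (Equivalence.from (PrincipalExt.spans E X) sp))
                   (trans (PrincipalExt.deletion E X)
                     (sym (trans (cong (suc (r M X) ⊓_) sp) (m≥n⇒m⊓n≡n (n≤1+n _)))))
  ... | no ¬sp = trans (≤-antisym ub lb) (sym (m≤n⇒m⊓n≡m (≤∧≢⇒< (r-≤∪ M X F) (¬sp ∘ sym))))
    where
    ≡∪ : true ∷ X ≡ (false ∷ X) ∪ ⁅ zero ⁆
    ≡∪ = cong (true ∷_) (sym (∪-identityʳ X))
    del = PrincipalExt.deletion E X
    ub : r M' (true ∷ X) ≤ suc (r M X)
    ub = ≤-trans (≤-reflexive (cong (r M') ≡∪)) (≤-trans (r-∪⁅⁆ M' (false ∷ X) zero) (≤-reflexive (cong suc del)))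
    lb : suc (r M X) ≤ r M' (true ∷ X)
    lb = ≤∧≢⇒< (≤-trans (≤-reflexive (sym del)) (r-mono M' (out⊆ ⊆-refl)))
               (λ eq → ¬sp (Equivalence.to (PrincipalExt.spans E X) (trans (cong (r M') (sym ≡∪)) (trans (sym eq) (sym del)))))

  principal-rank-cl : ∀ {G} → PrincipalExt M (cl M G) M' → ∀ X → r M' (true ∷ X) ≡ suc (r M X) ⊓ r M (X ∪ G)
  principal-rank-cl {G} E X = trans (principal-rank E X) (cong (suc (r M X) ⊓_) (r-∪-cl M X G))

module _ {n} (M : Matroid n) (F : Subset n) where

  private
    -- By `principal-rank` no other rank function is possible. What takes work is submodularity.
    rk : Subset (suc n) → ℕ
    rk (false ∷ X) = r M X
    rk (true ∷ X)  = suc (r M X) ⊓ r M (X ∪ F)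

    rk-card : ∀ X → rk X ≤ ∣ X ∣
    rk-card (false ∷ X) = r-card M X
    rk-card (true ∷ X)  = ≤-trans (m⊓n≤m _ _) (s≤s (r-card M X))

    rk-mono : ∀ {X Y} → X ⊆ Y → rk X ≤ rk Y
    rk-mono {false ∷ X} {false ∷ Y} X⊆Y = r-mono M (drop-∷-⊆ X⊆Y)
    rk-mono {false ∷ X} {true ∷ Y}  X⊆Y = ⊓-glb (m≤n⇒m≤1+n (r-mono M X⊆Y')) (r-mono M (⊆-∪ˡ {X = X} F X⊆Y'))
      where X⊆Y' = drop-∷-⊆ X⊆Y
    rk-mono {true ∷ X}  {false ∷ Y} X⊆Y with X⊆Y here
    ... | ()
    rk-mono {true ∷ X}  {true ∷ Y}  X⊆Y = ⊓-mono-≤ (s≤s (r-mono M X⊆Y')) (r-mono M (∪-monoˡ-⊆ F X⊆Y'))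
      where X⊆Y' = drop-∷-⊆ X⊆Y

    submod-⊆ : ∀ X Y {U I} → U ⊆ X ∪ Y → I ⊆ X ∩ Y → r M U + r M I ≤ r M X + r M Y
    submod-⊆ X Y U⊆ I⊆ = ≤-trans (+-mono-≤ (r-mono M U⊆) (r-mono M I⊆)) (r-submod M X Y)

    mixed : ∀ X Y → r M (X ∪ Y ∪ F) + r M (X ∩ Y) ≤ r M (X ∪ F) + r M Y
    mixed X Y = submod-⊆ (X ∪ F) Y
      (∪-lub {X = X} (⊆-∪ˡ {X = X} Y (p⊆p∪q F)) (∪-lub {X = Y} (q⊆p∪q (X ∪ F) Y) (⊆-∪ˡ {X = F} Y (q⊆p∪q X F))))
      (λ e∈ → let e∈X , e∈Y = x∈p∩q⁻ X Y e∈ in x∈p∩q⁺ (p⊆p∪q F e∈X , e∈Y))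

    sum-⊓ : ∀ a b c d {v} → v ≤ a + c → v ≤ a + d → v ≤ b + c → v ≤ b + d → v ≤ (a ⊓ b) + (c ⊓ d)
    sum-⊓ a b c d ac ad bc bd with ⊓-sel a b | ⊓-sel c d
    ... | inj₁ p | inj₁ q rewrite p | q = ac
    ... | inj₁ p | inj₂ q rewrite p | q = ad
    ... | inj₂ p | inj₁ q rewrite p | q = bc
    ... | inj₂ p | inj₂ q rewrite p | q = bd

    rk-submod-tf : ∀ X Y → suc (r M (X ∪ Y)) ⊓ r M ((X ∪ Y) ∪ F) + r M (X ∩ Y) ≤ suc (r M X) ⊓ r M (X ∪ F) + r M Y
    rk-submod-tf X Y with ⊓-sel (suc (r M X)) (r M (X ∪ F))
    ... | inj₁ p rewrite p = ≤-trans (+-monoˡ-≤ (r M (X ∩ Y)) (m⊓n≤m (suc (r M (X ∪ Y))) _)) (s≤s (r-submod M X Y))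
    ... | inj₂ p rewrite p = ≤-trans (+-monoˡ-≤ _ (≤-trans (m⊓n≤n _ _) (≤-reflexive (cong (r M) (∪-assoc X Y F))))) (mixed X Y)

    rk-submod : ∀ X Y → rk (X ∪ Y) + rk (X ∩ Y) ≤ rk X + rk Y
    rk-submod (false ∷ X) (false ∷ Y) = r-submod M X Y
    rk-submod (true ∷ X)  (false ∷ Y) = rk-submod-tf X Y
    rk-submod (false ∷ X) (true ∷ Y)  = begin
      suc (r M (X ∪ Y)) ⊓ r M ((X ∪ Y) ∪ F) + r M (X ∩ Y)
        ≡⟨ cong₂ (λ U I → suc (r M U) ⊓ r M (U ∪ F) + r M I) (∪-comm X Y) (∩-comm X Y) ⟩
      suc (r M (Y ∪ X)) ⊓ r M ((Y ∪ X) ∪ F) + r M (Y ∩ X)  ≤⟨ rk-submod-tf Y X ⟩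
      suc (r M Y) ⊓ r M (Y ∪ F) + r M X                    ≡⟨ +-comm _ (r M X) ⟩
      r M X + suc (r M Y) ⊓ r M (Y ∪ F)                    ∎
      where open ≤-Reasoning
    -- One bound for each choice of the terms attaining the two minima. In the mixed cases the union
    -- absorbs `F` and the intersection pays the extra one; only when both choices contain `F` does
    -- the intersection use its term with `F`.
    rk-submod (true ∷ X) (true ∷ Y) = sum-⊓ (suc (r M X)) (r M (X ∪ F)) (suc (r M Y)) (r M (Y ∪ F))
      (≤-trans (+-mono-≤ u₁ i₁) (s≤s (≤-trans (≤-reflexive (+-suc _ _)) (≤-trans (s≤s (r-submod M X Y)) (≤-reflexive (sym (+-suc _ _)))))))
      (≤-trans (+-mono-≤ u₂' i₁) (≤-trans (≤-reflexive (+-suc _ _)) (s≤s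
        (≤-trans (+-monoʳ-≤ _ (≤-reflexive (cong (r M) (∩-comm X Y)))) (≤-trans (mixed Y X) (≤-reflexive (+-comm (r M (Y ∪ F)) (r M X))))))))
      (≤-trans (+-mono-≤ u₂ i₁) (≤-trans (≤-reflexive (+-suc _ _)) (≤-trans (s≤s (mixed X Y)) (≤-reflexive (sym (+-suc _ _))))))
      (≤-trans (+-mono-≤ u₂ (m⊓n≤n _ _)) (submod-⊆ (X ∪ F) (Y ∪ F)
        (∪-lub {X = X} (⊆-∪ˡ {X = X} (Y ∪ F) (p⊆p∪q F)) (q⊆p∪q (X ∪ F) (Y ∪ F)))
        (∪-lub {X = X ∩ Y} (λ e∈ → let e∈X , e∈Y = x∈p∩q⁻ X Y e∈ in x∈p∩q⁺ (p⊆p∪q F e∈X , p⊆p∪q F e∈Y))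
          (λ e∈F → x∈p∩q⁺ (q⊆p∪q X F e∈F , q⊆p∪q Y F e∈F)))))
      where
      u₁ : suc (r M (X ∪ Y)) ⊓ r M ((X ∪ Y) ∪ F) ≤ suc (r M (X ∪ Y))
      u₁ = m⊓n≤m _ _
      u₂ : suc (r M (X ∪ Y)) ⊓ r M ((X ∪ Y) ∪ F) ≤ r M (X ∪ Y ∪ F)
      u₂ = ≤-trans (m⊓n≤n _ _) (≤-reflexive (cong (r M) (∪-assoc X Y F)))
      u₂' : suc (r M (X ∪ Y)) ⊓ r M ((X ∪ Y) ∪ F) ≤ r M (Y ∪ X ∪ F)
      u₂' = ≤-trans (m⊓n≤n _ _) (≤-reflexive (cong (r M) (trans (cong (_∪ F) (∪-comm X Y)) (∪-assoc Y X F))))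
      i₁ : suc (r M (X ∩ Y)) ⊓ r M ((X ∩ Y) ∪ F) ≤ suc (r M (X ∩ Y))
      i₁ = m⊓n≤m _ _

  principalExt : Matroid (suc n)
  principalExt = record { r = rk ; r-card = rk-card ; r-mono = λ {X} {Y} → rk-mono {X} {Y} ; r-submod = rk-submod }

  principalExt-isPrincipal : PrincipalExt M F principalExt
  principalExt-isPrincipal = record { deletion = λ _ → refl ; spans = λ X → mk⇔ (to X) (from X) }
    where
    to : ∀ X → SpansElt principalExt (false ∷ X) zero → Spans M X F
    to X sp with ⊓-sel (suc (r M (X ∪ ∅))) (r M ((X ∪ ∅) ∪ F))
    ... | inj₁ p = contradiction (trans (cong (λ Y → suc (r M Y)) (sym (∪-identityʳ X))) (trans (sym p) sp)) 1+n≢n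
    ... | inj₂ p = trans (cong (λ Y → r M (Y ∪ F)) (sym (∪-identityʳ X))) (trans (sym p) sp)
    from : ∀ X → Spans M X F → SpansElt principalExt (false ∷ X) zero
    from X sp = trans (cong (λ Y → suc (r M Y) ⊓ r M (Y ∪ F)) (∪-identityʳ X))
                      (trans (cong (suc (r M X) ⊓_) sp) (m≥n⇒m⊓n≡n (n≤1+n _)))

-- Direct sums and minors

module _ {n₁ n₂} (M₁ : Matroid n₁) (M₂ : Matroid n₂) where

  private
    rk : Subset (n₁ + n₂) → ℕ
    rk X = r M₁ (take n₁ X) + r M₂ (drop n₁ X)

    take-⊆ : ∀ {X Y : Subset (n₁ + n₂)} → X ⊆ Y → take n₁ X ⊆ take n₁ Y
    take-⊆ {X} {Y} X⊆Y {i} i∈ = ∈-++⁻ˡ {Y = drop n₁ Y} i (subst (_ ∈_) (sym (take++drop≡id n₁ Y))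
      (X⊆Y (subst (_ ∈_) (take++drop≡id n₁ X) (∈-++⁺ˡ i∈))))

    drop-⊆ : ∀ {X Y : Subset (n₁ + n₂)} → X ⊆ Y → drop n₁ X ⊆ drop n₁ Y
    drop-⊆ {X} {Y} X⊆Y {i} i∈ = ∈-++⁻ʳ (take n₁ Y) (subst (_ ∈_) (sym (take++drop≡id n₁ Y))
      (X⊆Y (subst (_ ∈_) (take++drop≡id n₁ X) (∈-++⁺ʳ (take n₁ X) i∈))))

    interchange : ∀ a b c d → (a + b) + (c + d) ≡ (a + c) + (b + d)
    interchange = solve 4 (λ a b c d → (a :+ b) :+ (c :+ d) := (a :+ c) :+ (b :+ d)) refl

    rk-submod : ∀ X Y → rk (X ∪ Y) + rk (X ∩ Y) ≤ rk X + rk Y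
    rk-submod X Y rewrite take-zipWith {m = n₁} _∨_ X Y | drop-zipWith {m = n₁} _∨_ X Y
                        | take-zipWith {m = n₁} _∧_ X Y | drop-zipWith {m = n₁} _∧_ X Y =
      ≤-trans (≤-reflexive (interchange (r M₁ (X₁ ∪ Y₁)) _ _ _))
        (≤-trans (+-mono-≤ (r-submod M₁ X₁ Y₁) (r-submod M₂ X₂ Y₂)) (≤-reflexive (interchange (r M₁ X₁) _ _ _)))
      where
      X₁ = take n₁ X
      X₂ = drop n₁ X
      Y₁ = take n₁ Y
      Y₂ = drop n₁ Y

  directSum : Matroid (n₁ + n₂)
  directSum = record
    { r        = rk
    ; r-card   = λ X → ≤-trans (+-mono-≤ (r-card M₁ (take n₁ X)) (r-card M₂ (drop n₁ X)))
                   (≤-reflexive (trans (sym (∣++∣ (take n₁ X) (drop n₁ X))) (cong ∣_∣ (take++drop≡id n₁ X))))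
    ; r-mono   = λ {X} {Y} X⊆Y → +-mono-≤ (r-mono M₁ (take-⊆ {X} {Y} X⊆Y)) (r-mono M₂ (drop-⊆ {X} {Y} X⊆Y))
    ; r-submod = rk-submod
    }

  directSum-isDirectSum : DirectSum M₁ M₂ directSum
  directSum-isDirectSum X Y = cong₂ (λ U V → r M₁ U + r M₂ V) (++-injectiveˡ (take n₁ (X ++ Y)) X eq) (++-injectiveʳ (take n₁ (X ++ Y)) X eq)
    where
    eq = take++drop≡id n₁ (X ++ Y)

module _ {k n} (M : Matroid n) (C : Subset n) (f : Fin k → Fin n) where

  private
    rk : Subset k → ℕ
    rk X = r M (image f X ∪ C) ∸ r M C

    C≤ : ∀ X → r M C ≤ r M (image f X ∪ C)
    C≤ X = r-mono M (q⊆p∪q (image f X) C)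

    rk-def : ∀ X → rk X + r M C ≡ r M (image f X ∪ C)
    rk-def X = m∸n+n≡m (C≤ X)

    rk-card : ∀ X → rk X ≤ ∣ X ∣
    rk-card X = +-cancelʳ-≤ (r M C) _ _ (begin
      rk X + r M C             ≡⟨ rk-def X ⟩
      r M (image f X ∪ C)      ≡⟨ cong (r M) (∪-comm (image f X) C) ⟩
      r M (C ∪ image f X)      ≤⟨ r-∪-card M C (image f X) ⟩
      r M C + ∣ image f X ∣    ≤⟨ +-monoʳ-≤ (r M C) (∣image∣≤ f X) ⟩
      r M C + ∣ X ∣            ≡⟨ +-comm (r M C) ∣ X ∣ ⟩
      ∣ X ∣ + r M C            ∎)
      where open ≤-Reasoning

    interchange : ∀ a b c → (a + b) + (c + c) ≡ (a + c) + (b + c)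
    interchange = solve 3 (λ a b c → (a :+ b) :+ (c :+ c) := (a :+ c) :+ (b :+ c)) refl

    rk-submod : ∀ X Y → rk (X ∪ Y) + rk (X ∩ Y) ≤ rk X + rk Y
    rk-submod X Y = +-cancelʳ-≤ (r M C + r M C) _ _ (begin
      (rk (X ∪ Y) + rk (X ∩ Y)) + (r M C + r M C)                ≡⟨ interchange (rk (X ∪ Y)) _ _ ⟩
      (rk (X ∪ Y) + r M C) + (rk (X ∩ Y) + r M C)                ≡⟨ cong₂ _+_ (rk-def (X ∪ Y)) (rk-def (X ∩ Y)) ⟩
      r M (image f (X ∪ Y) ∪ C) + r M (image f (X ∩ Y) ∪ C)      ≤⟨ +-mono-≤ (r-mono M ∪⊆) (r-mono M ∩⊆) ⟩
      r M (fX ∪ fY) + r M (fX ∩ fY)                              ≤⟨ r-submod M fX fY ⟩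
      r M fX + r M fY                                            ≡⟨ cong₂ _+_ (rk-def X) (rk-def Y) ⟨
      (rk X + r M C) + (rk Y + r M C)                            ≡⟨ interchange (rk X) _ _ ⟨
      (rk X + rk Y) + (r M C + r M C)                            ∎)
      where
      open ≤-Reasoning
      fX = image f X ∪ C
      fY = image f Y ∪ C
      ∪⊆ : image f (X ∪ Y) ∪ C ⊆ fX ∪ fY
      ∪⊆ rewrite image-∪ f X Y = ∪-lub {X = image f X ∪ image f Y}
        (∪-lub {X = image f X} (⊆-∪ˡ {X = image f X} fY (p⊆p∪q C)) (⊆-∪ʳ {X = image f Y} fX (p⊆p∪q C)))
        (⊆-∪ˡ {X = C} fY (q⊆p∪q (image f X) C))
      ∩⊆ : image f (X ∩ Y) ∪ C ⊆ fX ∩ fY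
      ∩⊆ e∈ = x∈p∩q⁺ (∪-monoˡ-⊆ C (image-mono f (p∩q⊆p X Y)) e∈ , ∪-monoˡ-⊆ C (image-mono f (p∩q⊆q X Y)) e∈)

  -- f need not be injective: elements with the same image become parallel.
  pullback : Matroid k
  pullback = record { r = rk ; r-card = rk-card ; r-mono = λ X⊆Y → ∸-monoˡ-≤ (r M C) (r-mono M (∪-monoˡ-⊆ C (image-mono f X⊆Y))) ; r-submod = rk-submod }

  pullback-rank : ∀ X → r pullback X + r M C ≡ r M (image f X ∪ C)
  pullback-rank = rk-def

-- The first minor is a pure deletion, so it brings in no contraction term. This turns a minor of
-- M(L,p,q;N,A,B) into a minor of `M₁`, where the rank formula is available.
minorVia-∘ : ∀ {n k j} {M : Matroid n} {M' : Matroid k} {K : Matroid j} {D₀ C D g f} →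
             MinorVia M M' ∅ D₀ g → MinorVia M' K C D f →
             MinorVia M K (image g C) (D₀ ∪ image g D) (g ∘ f)
minorVia-∘ {M = M} {M'} {K} {D₀} {C} {D} {g} {f} V W = record
  { disjoint = λ e → disj
  ; f-inj    = W.f-inj ∘ V.f-inj
  ; f-avoid  = λ i → (λ i∈ → proj₁ (W.f-avoid i) (pull i∈)) , avoidD i
  ; f-onto   = onto
  ; rank     = λ X → begin
      r K X + r M (image g C)                  ≡⟨ cong (r K X +_) (rank-g C) ⟨
      r K X + r M' C                           ≡⟨ W.rank X ⟩
      r M' (image f X ∪ C)                     ≡⟨ rank-g _ ⟩
      r M (image g (image f X ∪ C))            ≡⟨ cong (r M) (image-∪ g (image f X) C) ⟩
      r M (image g (image f X) ∪ image g C)    ≡⟨ cong (λ Y → r M (Y ∪ image g C)) (image-∘ g f X) ⟨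
      r M (image (g ∘ f) X ∪ image g C)        ∎
  }
  where
  open ≡-Reasoning
  module V = MinorVia V
  module W = MinorVia W
  rank-g : ∀ X → r M' X ≡ r M (image g X)
  rank-g X = trans (sym (trans (cong (r M' X +_) (r-∅ M)) (+-identityʳ _)))
                   (trans (V.rank X) (cong (r M) (∪-identityʳ _)))
  pull : ∀ {i X} → g i ∈ image g X → i ∈ X
  pull {X = X} i∈ with ∈-image⁻ g X i∈
  ... | h , h∈ , eq = subst (_∈ _) (V.f-inj eq) h∈
  avoidD : ∀ i → g (f i) ∉ D₀ ∪ image g D
  avoidD i i∈ with x∈p∪q⁻ D₀ _ i∈
  ... | inj₁ i∈D₀ = proj₂ (V.f-avoid (f i)) i∈D₀
  ... | inj₂ i∈gD = proj₂ (W.f-avoid i) (pull i∈gD)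
  disj : ∀ {e} → e ∈ image g C → e ∈ D₀ ∪ image g D → ⊥
  disj e∈C e∈D with ∈-image⁻ g C e∈C
  ... | i , i∈C , refl with x∈p∪q⁻ D₀ _ e∈D
  ... | inj₁ i∈D₀ = proj₂ (V.f-avoid i) i∈D₀
  ... | inj₂ i∈gD = W.disjoint i i∈C (pull i∈gD)
  onto : ∀ e → e ∉ image g C → e ∉ D₀ ∪ image g D → ∃ λ i → g (f i) ≡ e
  onto e e∉C e∉D with V.f-onto e ∉⊥ (e∉D ∘ p⊆p∪q _)
  ... | i , refl with W.f-onto i (e∉C ∘ ∈-image⁺ g) (e∉D ∘ q⊆p∪q D₀ _ ∘ ∈-image⁺ g)
  ... | h , refl = h , refl

-- A minor sees only the ranks of sets that contain `C` and avoid `D`, and of these only the excess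
-- over the rank of `C`; a constant discrepancy `c` cancels.
minorVia-transfer : ∀ {n j} {M M' : Matroid n} {K : Matroid j} {C D f} c →
                    (∀ X → C ⊆ X → (∀ {e} → e ∈ X → e ∉ D) → r M X ≡ r M' X + c) →
                    MinorVia M K C D f → MinorVia M' K C D f
minorVia-transfer {M = M} {M'} {K} {C} {D} {f} c eq V = record
  { disjoint = V.disjoint ; f-inj = V.f-inj ; f-avoid = V.f-avoid ; f-onto = V.f-onto
  ; rank = λ X → +-cancelʳ-≡ c _ _ (begin
      r K X + r M' C + c           ≡⟨ +-assoc (r K X) _ _ ⟩
      r K X + (r M' C + c)         ≡⟨ cong (r K X +_) (eq C ⊆-refl (λ {e} → V.disjoint e)) ⟨
      r K X + r M C                ≡⟨ V.rank X ⟩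
      r M (image f X ∪ C)          ≡⟨ eq _ (q⊆p∪q (image f X) C) (avoid X) ⟩
      r M' (image f X ∪ C) + c     ∎)
  }
  where
  open ≡-Reasoning
  module V = MinorVia V
  avoid : ∀ X {e} → e ∈ image f X ∪ C → e ∉ D
  avoid X e∈ with x∈p∪q⁻ (image f X) C e∈
  ... | inj₂ e∈C = V.disjoint _ e∈C
  ... | inj₁ e∈f with ∈-image⁻ f X e∈f
  ... | i , _ , refl = proj₂ (V.f-avoid i)

-- The rank function of the construction

-- R is the rank of N. A set consists of s elements of A ∪ {a}, t elements of B ∪ {b}, with n the rank in N
-- of the elements of N among them, and a subset X of L; the ranks in L of X, X ∪ p, X ∪ q and X ∪ {p, q}
-- are x, P, Q and Z.
minRank : (R s t n x P Q Z : ℕ) → ℕ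
minRank R s t n x P Q Z =
  ((x + (s + t)) ⊓ (2 + (x + n))) ⊓ ((((1 ⊓ t) + (R + P)) ⊓ ((1 ⊓ s) + (R + Q))) ⊓ (R + Z))

module MinRank (R s t n x P Q Z : ℕ) where

  private
    value = minRank R s t n x P Q Z
    u v : ℕ
    u = (x + (s + t)) ⊓ (2 + (x + n))
    v = ((1 ⊓ t) + (R + P)) ⊓ ((1 ⊓ s) + (R + Q))

  ≤₁ : value ≤ x + (s + t)
  ≤₁ = ≤-trans (m⊓n≤m _ _) (m⊓n≤m _ _)

  ≤₂ : value ≤ 2 + (x + n)
  ≤₂ = ≤-trans (m⊓n≤m _ _) (m⊓n≤n (x + (s + t)) _)

  ≤₃ : value ≤ (1 ⊓ t) + (R + P)
  ≤₃ = ≤-trans (m⊓n≤n u _) (≤-trans (m⊓n≤m _ _) (m⊓n≤m _ _))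

  ≤₄ : value ≤ (1 ⊓ s) + (R + Q)
  ≤₄ = ≤-trans (m⊓n≤n u _) (≤-trans (m⊓n≤m _ _) (m⊓n≤n ((1 ⊓ t) + (R + P)) _))

  ≤₅ : value ≤ R + Z
  ≤₅ = ≤-trans (m⊓n≤n u _) (m⊓n≤n v _)

  glb : ∀ {w} → w ≤ x + (s + t) → w ≤ 2 + (x + n) → w ≤ (1 ⊓ t) + (R + P) →
        w ≤ (1 ⊓ s) + (R + Q) → w ≤ R + Z → w ≤ value
  glb w₁ w₂ w₃ w₄ w₅ = ⊓-glb (⊓-glb w₁ w₂) (⊓-glb (⊓-glb w₃ w₄) w₅)

module _ (R s t n x P Q Z : ℕ) where

  private
    module G = MinRank R s t n x P Q Z

  minRank-swap : minRank R s t n x P Q Z ≡ minRank R t s n x Q P Z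
  minRank-swap = cong₂ (λ u v → (u ⊓ (2 + (x + n))) ⊓ (v ⊓ (R + Z)))
    (cong (x +_) (+-comm s t)) (⊓-comm ((1 ⊓ t) + (R + P)) ((1 ⊓ s) + (R + Q)))

  -- Each of the five terms contains exactly one rank of `L`. Contracting an element of `L` lowers
  -- all four of these ranks by the same amount.
  minRank-shift : ∀ c → minRank R s t n (x + c) (P + c) (Q + c) (Z + c) ≡ minRank R s t n x P Q Z + c
  minRank-shift c = sym (begin
    ((x + (s + t)) ⊓ (2 + (x + n))) ⊓ ((T ⊓ S) ⊓ (R + Z)) + c
      ≡⟨ dist ((x + (s + t)) ⊓ (2 + (x + n))) ((T ⊓ S) ⊓ (R + Z)) ⟩
    (((x + (s + t)) ⊓ (2 + (x + n))) + c) ⊓ (((T ⊓ S) ⊓ (R + Z)) + c)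
      ≡⟨ cong₂ _⊓_ (dist (x + (s + t)) (2 + (x + n))) (trans (dist (T ⊓ S) (R + Z)) (cong (_⊓ ((R + Z) + c)) (dist T S))) ⟩
    ((x + (s + t) + c) ⊓ (2 + (x + n) + c)) ⊓ (((T + c) ⊓ (S + c)) ⊓ (R + Z + c))
      ≡⟨ cong₂ _⊓_ (cong₂ _⊓_ (swap x (s + t) c) (cong (2 +_) (swap x n c)))
           (cong₂ _⊓_ (cong₂ _⊓_ (assoc (1 ⊓ t) R P c) (assoc (1 ⊓ s) R Q c)) (+-assoc R Z c)) ⟩
    minRank R s t n (x + c) (P + c) (Q + c) (Z + c) ∎)
    where
    open ≡-Reasoning
    T S : ℕ
    T = (1 ⊓ t) + (R + P)
    S = (1 ⊓ s) + (R + Q)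
    dist : ∀ u v → u ⊓ v + c ≡ (u + c) ⊓ (v + c)
    dist = +-distribʳ-⊓ c
    swap : ∀ u v w → u + v + w ≡ u + w + v
    swap = solve 3 (λ u v w → u :+ v :+ w := u :+ w :+ v) refl
    assoc : ∀ u v w z → u + (v + w) + z ≡ u + (v + (w + z))
    assoc = solve 4 (λ u v w z → u :+ (v :+ w) :+ z := u :+ (v :+ (w :+ z))) refl

  -- Redirecting p to q replaces P by suc x ⊓ Z. This only matters when X spans p but not q; then the term
  -- with P is dominated by the last one if t > 0, and by the first one if t = 0.
  minRank-delete : s ≤ R → x ≤ P → P ≤ suc x → P ≤ Z → Z ≤ suc P →
                   minRank R s t n x P Q Z ≡ minRank R s t n x (suc x ⊓ Z) Q Z
  minRank-delete s≤R x≤P P≤1+x P≤Z Z≤1+P = ≤-antisym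
    (G'.glb G.≤₁ G.≤₂ (≤-trans G.≤₃ (+-monoʳ-≤ (1 ⊓ t) (+-monoʳ-≤ R (⊓-glb P≤1+x P≤Z)))) G.≤₄ G.≤₅)
    (G.glb G'.≤₁ G'.≤₂ (third t refl) G'.≤₄ G'.≤₅)
    where
    module G' = MinRank R s t n x (suc x ⊓ Z) Q Z
    open ≤-Reasoning
    third : ∀ t' → t' ≡ t → minRank R s t n x (suc x ⊓ Z) Q Z ≤ (1 ⊓ t') + (R + P)
    third zero    refl = begin
      minRank R s t n x (suc x ⊓ Z) Q Z  ≤⟨ G'.≤₁ ⟩
      x + (s + 0)                        ≡⟨ cong (x +_) (+-identityʳ s) ⟩
      x + s                              ≡⟨ +-comm x s ⟩
      s + x                              ≤⟨ +-mono-≤ s≤R x≤P ⟩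
      R + P                              ∎
    third (suc _) refl = ≤-trans G'.≤₅ (≤-trans (+-monoʳ-≤ R Z≤1+P) (≤-reflexive (+-suc R P)))

  -- `Q` enters the fourth term only. For `s > 0` that term is `R + Q + 1`, which is at least
  -- `R + Z`, so raising `Q` changes nothing.
  minRank-contract : 1 ≤ s → Q ≤ suc x → Q ≤ Z → Z ≤ suc Q →
                     minRank R s t n x P Q Z ≡ minRank R s t n x P (suc x ⊓ Z) Z
  minRank-contract 1≤s Q≤1+x Q≤Z Z≤1+Q = ≤-antisym
    (G'.glb G.≤₁ G.≤₂ G.≤₃ (≤-trans G.≤₄ (+-monoʳ-≤ (1 ⊓ s) (+-monoʳ-≤ R (⊓-glb Q≤1+x Q≤Z)))) G.≤₅)
    (G.glb G'.≤₁ G'.≤₂ G'.≤₃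
      (≤-trans G'.≤₅ (≤-trans (+-monoʳ-≤ R Z≤1+Q) (≤-trans (≤-reflexive (+-suc R Q))
        (≤-reflexive (cong (_+ (R + Q)) (sym (m≤n⇒m⊓n≡m 1≤s)))))))
      G'.≤₅)
    where
    module G' = MinRank R s t n x P (suc x ⊓ Z) Z

-- Ranks along the successive extensions by a, b and the copies

bit : Bool → ℕ
bit b = if b then 1 else 0

module _ {m l : ℕ} where

  -- `IsM` without the final deletion, so that it can also be instantiated with another matroid on
  -- the ground set of `L`.
  record Construction (L : Matroid l) (p q : Fin l) (N : Matroid m) (A : Subset m)
                      (M₁ : Matroid (m + (2 + (m + l)))) : Set where
    field
      S0   : Matroid (m + l)
      S1   : Matroid (suc (m + l))
      S2   : Matroid (2 + (m + l))
      sum  : DirectSum N L S0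
      addA : PrincipalExt S0 (cl S0 (elemsN {m} {l} ∪ ⁅ posL {m} {l} p ⁆)) S1
      addB : PrincipalExt S1 (cl S1 (false ∷ (elemsN {m} {l} ∪ ⁅ posL {m} {l} q ⁆))) S2
      copies : Copies A S2 (allFin m) M₁

  ∪-elemsN : ∀ (Y : Subset m) (X : Subset l) u → (Y ++ X) ∪ (elemsN {m} {l} ∪ ⁅ posL {m} {l} u ⁆) ≡ full ++ (X ∪ ⁅ u ⁆)
  ∪-elemsN Y X u = begin
    (Y ++ X) ∪ (elemsN {m} {l} ∪ ⁅ m ↑ʳ u ⁆)           ≡⟨ cong (λ V → (Y ++ X) ∪ (elemsN {m} {l} ∪ V)) (⁅↑ʳ⁆ m u) ⟩
    (Y ++ X) ∪ (elemsN {m} {l} ∪ (∅ {m} ++ ⁅ u ⁆))     ≡⟨ cong ((Y ++ X) ∪_) (++-∪ (full {m}) ∅ ∅ ⁅ u ⁆) ⟩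
    (Y ++ X) ∪ ((full ∪ ∅) ++ (∅ ∪ ⁅ u ⁆))             ≡⟨ ++-∪ Y (full ∪ ∅) X (∅ ∪ ⁅ u ⁆) ⟩
    (Y ∪ (full ∪ ∅)) ++ (X ∪ (∅ ∪ ⁅ u ⁆))
      ≡⟨ cong₂ (λ V W → (Y ∪ V) ++ (X ∪ W)) (∪-identityʳ full) (∪-identityˡ ⁅ u ⁆) ⟩
    (Y ∪ full) ++ (X ∪ ⁅ u ⁆)                          ≡⟨ cong (_++ (X ∪ ⁅ u ⁆)) (∪-zeroʳ Y) ⟩
    full ++ (X ∪ ⁅ u ⁆)                                ∎
    where open ≡-Reasoning

  module _ {L : Matroid l} {N : Matroid m} {p q : Fin l} {A : Subset m} {M₁} (K : Construction L p q N A M₁) where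
    open Construction K

    private
      R : ℕ
      R = r N full
      rP rQ rZ : Subset l → ℕ
      rP X = r L (X ∪ ⁅ p ⁆)
      rQ X = r L (X ∪ ⁅ q ⁆)
      rZ X = r L ((X ∪ ⁅ p ⁆) ∪ ⁅ q ⁆)

    S1-rank-true : ∀ Y X → r S1 (true ∷ (Y ++ X)) ≡ suc (r N Y + r L X) ⊓ (R + rP X)
    S1-rank-true Y X = trans (principal-rank-cl addA (Y ++ X))
      (cong₂ (λ u v → suc u ⊓ v) (sum Y X) (trans (cong (r S0) (∪-elemsN Y X p)) (sum full _)))

    S1-rank-false : ∀ Y X → r S1 (false ∷ (Y ++ X)) ≡ r N Y + r L X
    S1-rank-false Y X = trans (PrincipalExt.deletion addA (Y ++ X)) (sum Y X)

    S2-rank-true : ∀ a Y X → r S2 (true ∷ a ∷ (Y ++ X)) ≡ suc (r S1 (a ∷ (Y ++ X))) ⊓ r S1 (a ∷ (full ++ (X ∪ ⁅ q ⁆)))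
    S2-rank-true a Y X = trans (principal-rank-cl addB (a ∷ (Y ++ X)))
      (cong₂ (λ c V → suc (r S1 (a ∷ (Y ++ X))) ⊓ r S1 (c ∷ V)) (∨-identityʳ a) (∪-elemsN Y X q))

    -- The four terms record which of `a` and `b` act as their full flats. For an absent one the
    -- additional terms are dominated, so a single formula covers all cases.
    S2-rank : ∀ b a Y X → r S2 (b ∷ a ∷ (Y ++ X)) ≡
              ((bit b + (bit a + (r N Y + r L X))) ⊓ (bit b + (R + rP X))) ⊓ ((bit a + (R + rQ X)) ⊓ (R + rZ X))
    S2-rank b a Y X = go b a
      where
      open ≡-Reasoning
      w : ℕ
      w = r N Y + r L X
      ≤P : w ≤ R + rP X
      ≤P = +-mono-≤ (r-mono N ⊆⊤) (r-≤∪ L X _)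
      ≤Q : w ≤ R + rQ X
      ≤Q = +-mono-≤ (r-mono N ⊆⊤) (r-≤∪ L X _)
      P≤Z : R + rP X ≤ R + rZ X
      P≤Z = +-monoʳ-≤ R (r-≤∪ L (X ∪ ⁅ p ⁆) _)
      Q≤Z : R + rQ X ≤ R + rZ X
      Q≤Z = +-monoʳ-≤ R (r-mono L (∪-monoˡ-⊆ ⁅ q ⁆ (p⊆p∪q ⁅ p ⁆)))
      go : ∀ b a → r S2 (b ∷ a ∷ (Y ++ X)) ≡
           ((bit b + (bit a + w)) ⊓ (bit b + (R + rP X))) ⊓ ((bit a + (R + rQ X)) ⊓ (R + rZ X))
      go false false = trans (PrincipalExt.deletion addB _) (trans (S1-rank-false Y X) (sym (begin
        (w ⊓ (R + rP X)) ⊓ ((R + rQ X) ⊓ (R + rZ X))  ≡⟨ cong₂ _⊓_ (m≤n⇒m⊓n≡m ≤P) (m≤n⇒m⊓n≡m Q≤Z) ⟩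
        w ⊓ (R + rQ X)                                ≡⟨ m≤n⇒m⊓n≡m ≤Q ⟩
        w                                             ∎)))
      go false true = trans (PrincipalExt.deletion addB _) (trans (S1-rank-true Y X)
        (sym (m≤n⇒m⊓n≡m (⊓-mono-≤ (s≤s ≤Q) P≤Z))))
      go true false = trans (S2-rank-true false Y X) (begin
        suc (r S1 (false ∷ (Y ++ X))) ⊓ r S1 (false ∷ (full ++ (X ∪ ⁅ q ⁆)))
          ≡⟨ cong₂ (λ u v → suc u ⊓ v) (S1-rank-false Y X) (S1-rank-false full (X ∪ ⁅ q ⁆)) ⟩
        suc w ⊓ (R + rQ X)
          ≡⟨ cong₂ _⊓_ (m≤n⇒m⊓n≡m (s≤s ≤P)) (m≤n⇒m⊓n≡m Q≤Z) ⟨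
        (suc w ⊓ suc (R + rP X)) ⊓ ((R + rQ X) ⊓ (R + rZ X)) ∎)
      go true true = trans (S2-rank-true true Y X)
        (cong₂ (λ u v → suc u ⊓ v) (S1-rank-true Y X)
          (trans (S1-rank-true full (X ∪ ⁅ q ⁆)) (cong (λ V → suc (R + rQ X) ⊓ (R + r L V)) (∪-swapʳ X ⁅ q ⁆ ⁅ p ⁆))))

  -- A copy that acts as its whole flat can be traded for the generators of that flat; `W` collects
  -- such copies.
  fill : ∀ (A : Subset m) {k} → Vec (Fin m) k → Subset k → Subset (2 + (m + l)) → Subset (2 + (m + l))
  fill A []       []          V = V
  fill A (x ∷ xs) (false ∷ W) V = fill A xs W V
  fill A (x ∷ xs) (true ∷ W)  V = fill A xs W (V ∪ (⁅ pos2N x ⁆ ∪ ⁅ partner A x ⁆))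

  module _ {A : Subset m} {S2 : Matroid (2 + (m + l))} where

    copies-step : ∀ {k} {K : Matroid (k + (2 + (m + l)))} {K' x} →
                  PrincipalExt K (cl K (⁅ k ↑ʳ pos2N x ⁆ ∪ ⁅ k ↑ʳ partner A x ⁆)) K' → ∀ U V →
                  r K' (true ∷ (U ++ V)) ≡ suc (r K (U ++ V)) ⊓ r K (U ++ (V ∪ (⁅ pos2N x ⁆ ∪ ⁅ partner A x ⁆)))
    copies-step {k} {K} {x = x} E U V = trans (principal-rank-cl E (U ++ V)) (cong (λ Y → suc (r K (U ++ V)) ⊓ r K Y) (begin
      (U ++ V) ∪ (⁅ k ↑ʳ pos2N x ⁆ ∪ ⁅ k ↑ʳ partner A x ⁆)  ≡⟨ cong₂ (λ Y Z → (U ++ V) ∪ (Y ∪ Z)) (⁅↑ʳ⁆ k _) (⁅↑ʳ⁆ k _) ⟩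
      (U ++ V) ∪ ((∅ ++ e) ∪ (∅ ++ f))                       ≡⟨ cong ((U ++ V) ∪_) (++-∪ (∅ {k}) ∅ e f) ⟩
      (U ++ V) ∪ ((∅ ∪ ∅) ++ (e ∪ f))                        ≡⟨ ++-∪ U (∅ ∪ ∅) V (e ∪ f) ⟩
      (U ∪ (∅ ∪ ∅)) ++ (V ∪ (e ∪ f))                         ≡⟨ cong (_++ (V ∪ (e ∪ f))) (trans (cong (U ∪_) (∪-idem ∅)) (∪-identityʳ U)) ⟩
      U ++ (V ∪ (e ∪ f))                                     ∎))
      where
      open ≡-Reasoning
      e f : Subset (2 + (m + l))
      e = ⁅ pos2N x ⁆
      f = ⁅ partner A x ⁆

    -- The choice in which no copy acts as its flat; `copies-≤-fill` is the opposite extreme. These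
    -- two choices alone supply all upper bounds in the rank formula.
    copies-≤-card : ∀ {k} {xs : Vec (Fin m) k} {K} → Copies A S2 xs K → ∀ U V → r K (U ++ V) ≤ ∣ U ∣ + r S2 V
    copies-≤-card done         []          V = ≤-refl
    copies-≤-card (step x c E) (false ∷ U) V = ≤-trans (≤-reflexive (PrincipalExt.deletion E (U ++ V))) (copies-≤-card c U V)
    copies-≤-card (step x c E) (true ∷ U)  V =
      ≤-trans (≤-reflexive (copies-step E U V)) (≤-trans (m⊓n≤m _ _) (s≤s (copies-≤-card c U V)))

    copies-≤-fill : ∀ {k} {xs : Vec (Fin m) k} {K} → Copies A S2 xs K → ∀ U V → r K (U ++ V) ≤ r S2 (fill A xs U V)
    copies-≤-fill done         []          V = ≤-refl
    copies-≤-fill (step x c E) (false ∷ U) V = ≤-trans (≤-reflexive (PrincipalExt.deletion E (U ++ V))) (copies-≤-fill c U V)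
    copies-≤-fill (step {K = K} x c E) (true ∷ U)  V =
      ≤-trans (≤-reflexive (copies-step E U V)) (≤-trans (m⊓n≤n (suc (r K (U ++ V))) _) (copies-≤-fill c U _))

    -- The rank is attained by letting the copies in W act as fully as possible, each remaining copy adding one.
    copies-≥ : ∀ {k} {xs : Vec (Fin m) k} {K} → Copies A S2 xs K → ∀ U V →
               ∃₂ λ W W' → U ⊆ W ∪ W' × ∣ W' ∣ + r S2 (fill A xs W V) ≤ r K (U ++ V)
    copies-≥ done [] V = [] , [] , (λ ()) , ≤-refl
    copies-≥ (step x c E) (false ∷ U) V with copies-≥ c U V
    ... | W , W' , U⊆ , le = false ∷ W , false ∷ W' , s⊆s U⊆ , ≤-trans le (≤-reflexive (sym (PrincipalExt.deletion E (U ++ V))))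
    copies-≥ (step {K = K} x c E) (true ∷ U) V
      with ⊓-sel (suc (r K (U ++ V))) (r K (U ++ (V ∪ (⁅ pos2N x ⁆ ∪ ⁅ partner A x ⁆))))
    ... | inj₁ eq with copies-≥ c U V
    ...   | W , W' , U⊆ , le = false ∷ W , true ∷ W' , s⊆s U⊆ , ≤-trans (s≤s le) (≤-reflexive (sym (trans (copies-step E U V) eq)))
    copies-≥ (step {K = K} x c E) (true ∷ U) V | inj₂ eq with copies-≥ c U (V ∪ (⁅ pos2N x ⁆ ∪ ⁅ partner A x ⁆))
    ...   | W , W' , U⊆ , le = true ∷ W , false ∷ W' , s⊆s U⊆ , ≤-trans le (≤-reflexive (sym (trans (copies-step E U V) eq)))

-- With `S = A` this is the bit of `a` after `fill`, with `S = ∁ A` that of `b`.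
fillBit : ∀ {m k} → Subset m → Vec (Fin m) k → Subset k → Bool → Bool
fillBit S []       []      a = a
fillBit S (x ∷ xs) (w ∷ W) a = fillBit S xs W (a ∨ (w ∧ lookup S x))

fillN : ∀ {m k} → Vec (Fin m) k → Subset k → Subset m → Subset m
fillN []       []          Y = Y
fillN (x ∷ xs) (false ∷ W) Y = fillN xs W Y
fillN (x ∷ xs) (true ∷ W)  Y = fillN xs W (Y ∪ ⁅ x ⁆)

module _ {m : ℕ} where

  fill-≡ : ∀ {l} A {k} (xs : Vec (Fin m) k) W b a Y (X : Subset l) →
           fill A xs W (b ∷ a ∷ (Y ++ X)) ≡ fillBit (∁ A) xs W b ∷ fillBit A xs W a ∷ (fillN xs W Y ++ X)
  fill-≡ A []       []          b a Y X = refl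
  fill-≡ A (x ∷ xs) (false ∷ W) b a Y X rewrite ∨-identityʳ a | ∨-identityʳ b = fill-≡ A xs W b a Y X
  fill-≡ {l} A (x ∷ xs) (true ∷ W) b a Y X = trans (cong (fill A xs W) eq) (fill-≡ A xs W _ _ (Y ∪ ⁅ x ⁆) X)
    where
    open ≡-Reasoning
    eqN : (Y ++ X) ∪ (⁅ x ↑ˡ l ⁆ ∪ ∅) ≡ (Y ∪ ⁅ x ⁆) ++ X
    eqN = begin
      (Y ++ X) ∪ (⁅ x ↑ˡ l ⁆ ∪ ∅)  ≡⟨ cong ((Y ++ X) ∪_) (trans (∪-identityʳ _) (⁅↑ˡ⁆ l x)) ⟩
      (Y ++ X) ∪ (⁅ x ⁆ ++ ∅)      ≡⟨ ++-∪ Y ⁅ x ⁆ X ∅ ⟩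
      (Y ∪ ⁅ x ⁆) ++ (X ∪ ∅)       ≡⟨ cong ((Y ∪ ⁅ x ⁆) ++_) (∪-identityʳ X) ⟩
      (Y ∪ ⁅ x ⁆) ++ X             ∎
    eq : (b ∷ a ∷ (Y ++ X)) ∪ (⁅ pos2N x ⁆ ∪ ⁅ partner A x ⁆) ≡ (b ∨ lookup (∁ A) x) ∷ (a ∨ lookup A x) ∷ ((Y ∪ ⁅ x ⁆) ++ X)
    eq rewrite lookup-map x not A with lookup A x
    ... | true  = cong (λ V → (b ∨ false) ∷ (a ∨ true) ∷ V) eqN
    ... | false = cong (λ V → (b ∨ true) ∷ (a ∨ false) ∷ V) eqN

  ∈-fillN⁺ : ∀ {k} (xs : Vec (Fin m) k) {W i} Y → lookup xs i ∈ Y ⊎ i ∈ W → lookup xs i ∈ fillN xs W Y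
  ∈-fillN⁺ xs {W} {i} Y = [ kept xs W Y , added xs W Y i ]′
    where
    kept : ∀ {k} (xs : Vec (Fin m) k) W Y {e} → e ∈ Y → e ∈ fillN xs W Y
    kept []       []          Y e∈Y = e∈Y
    kept (x ∷ xs) (false ∷ W) Y e∈Y = kept xs W Y e∈Y
    kept (x ∷ xs) (true ∷ W)  Y e∈Y = kept xs W _ (p⊆p∪q _ e∈Y)
    added : ∀ {k} (xs : Vec (Fin m) k) W Y i → i ∈ W → lookup xs i ∈ fillN xs W Y
    added (x ∷ xs) (true ∷ W)  Y zero    here        = kept xs W _ (q⊆p∪q Y _ (x∈⁅x⁆ x))
    added (x ∷ xs) (true ∷ W)  Y (suc i) (there i∈W) = added xs W _ i i∈W
    added (x ∷ xs) (false ∷ W) Y (suc i) (there i∈W) = added xs W Y i i∈W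

  ∈-fillN⁻ : ∀ {k} (xs : Vec (Fin m) k) W Y {e} → e ∈ fillN xs W Y → e ∈ Y ⊎ ∃ λ i → i ∈ W × lookup xs i ≡ e
  ∈-fillN⁻ []       []          Y e∈ = inj₁ e∈
  ∈-fillN⁻ (x ∷ xs) (false ∷ W) Y e∈ with ∈-fillN⁻ xs W Y e∈
  ... | inj₁ e∈Y            = inj₁ e∈Y
  ... | inj₂ (i , i∈W , eq) = inj₂ (suc i , there i∈W , eq)
  ∈-fillN⁻ (x ∷ xs) (true ∷ W)  Y e∈ with ∈-fillN⁻ xs W (Y ∪ ⁅ x ⁆) e∈
  ... | inj₂ (i , i∈W , eq) = inj₂ (suc i , there i∈W , eq)
  ... | inj₁ e∈Y∪x with x∈p∪q⁻ Y ⁅ x ⁆ e∈Y∪x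
  ...   | inj₁ e∈Y = inj₁ e∈Y
  ...   | inj₂ e∈x = inj₂ (zero , here , sym (x∈⁅y⁆⇒x≡y x e∈x))

  fillN-allFin : ∀ W → fillN (allFin m) W ∅ ≡ W
  fillN-allFin W = ⊆-antisym ⇒ ⇐
    where
    ⇒ : fillN (allFin m) W ∅ ⊆ W
    ⇒ e∈ with ∈-fillN⁻ (allFin m) W ∅ e∈
    ... | inj₁ e∈∅          = ⊥-elim (∉⊥ e∈∅)
    ... | inj₂ (i , i∈W , eq) = subst (_∈ W) (trans (sym (lookup-allFin i)) eq) i∈W
    ⇐ : W ⊆ fillN (allFin m) W ∅
    ⇐ {i} i∈W = subst (_∈ fillN (allFin m) W ∅) (lookup-allFin i) (∈-fillN⁺ (allFin m) ∅ (inj₂ i∈W))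

  module _ (S : Subset m) where

    fillBit-true : ∀ {k} (xs : Vec (Fin m) k) W → fillBit S xs W true ≡ true
    fillBit-true []       []      = refl
    fillBit-true (x ∷ xs) (w ∷ W) = fillBit-true xs W

    fillBit⁺ : ∀ {k} (xs : Vec (Fin m) k) W a i → i ∈ W → lookup S (lookup xs i) ≡ true → fillBit S xs W a ≡ true
    fillBit⁺ (x ∷ xs) (true ∷ W) a zero    here        eq rewrite eq | ∨-zeroʳ a = fillBit-true xs W
    fillBit⁺ (x ∷ xs) (w ∷ W)    a (suc i) (there i∈W) eq = fillBit⁺ xs W _ i i∈W eq

    fillBit⁻ : ∀ {k} (xs : Vec (Fin m) k) W a → fillBit S xs W a ≡ true →
               a ≡ true ⊎ ∃ λ i → i ∈ W × lookup S (lookup xs i) ≡ true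
    fillBit⁻ []       []      a eq = inj₁ eq
    fillBit⁻ (x ∷ xs) (w ∷ W) a eq with fillBit⁻ xs W _ eq
    ... | inj₂ (i , i∈W , eq') = inj₂ (suc i , there i∈W , eq')
    fillBit⁻ (x ∷ xs) (w ∷ W)    true  eq | inj₁ _   = inj₁ refl
    fillBit⁻ (x ∷ xs) (true ∷ W) false eq | inj₁ eq' = inj₂ (zero , here , eq')

    hit : Subset m → Bool → Bool
    hit = fillBit S (allFin m)

    hit-∈ : ∀ {W i} a → i ∈ W → i ∈ S → hit W a ≡ true
    hit-∈ {W} {i} a i∈W i∈S = fillBit⁺ (allFin m) W a i i∈W (trans (cong (lookup S) (lookup-allFin i)) ([]=⇒lookup i∈S))

    bit≤hit : ∀ W a → bit a ≤ bit (hit W a)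
    bit≤hit W false = z≤n
    bit≤hit W true rewrite fillBit-true (allFin m) W = ≤-refl

    hit≤ : ∀ U a → bit (hit U a) ≤ 1 ⊓ (bit a + ∣ U ∩ S ∣)
    hit≤ U a with hit U a in eq
    ... | false = z≤n
    ... | true with fillBit⁻ (allFin m) U a eq
    ...   | inj₁ refl = ≤-refl
    ...   | inj₂ (i , i∈U , eq') = ⊓-glb ≤-refl (≤-trans (∈⇒1≤∣∣ (x∈p∩q⁺ {p = U} {S} (i∈U ,
              lookup⇒[]= i S (trans (cong (lookup S) (sym (lookup-allFin i))) eq')))) (m≤n+m _ (bit a)))

    -- An element of `U ∩ S` lies in `W`, which turns the bit on, or in `W'`, which then counts it.
    -- This accounts for the summands `[s > 0]` and `[t > 0]`.
    ≤hit : ∀ {U W W'} a → U ⊆ W ∪ W' → 1 ⊓ (bit a + ∣ U ∩ S ∣) ≤ ∣ W' ∣ + bit (hit W a)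
    ≤hit {U} {W} {W'} true U⊆ = ≤-trans (bit≤hit W true) (m≤n+m _ ∣ W' ∣)
    ≤hit {U} {W} {W'} false U⊆ with nonempty? (U ∩ S)
    ... | no empty rewrite Empty-unique empty | ∣⊥∣≡0 m = z≤n
    ... | yes (i , i∈) with x∈p∩q⁻ U S i∈
    ...   | i∈U , i∈S with x∈p∪q⁻ W W' (U⊆ i∈U)
    ...     | inj₁ i∈W  rewrite hit-∈ false i∈W i∈S = ≤-trans (m⊓n≤m 1 _) (m≤n+m _ ∣ W' ∣)
    ...     | inj₂ i∈W' = ≤-trans (m⊓n≤m 1 _) (≤-trans (∈⇒1≤∣∣ i∈W') (m≤m+n _ _))

module _ {m l : ℕ} where

  -- The block of `N` is empty because the original elements of `N` are deleted.
  place : Subset m → Bool → Bool → Subset l → Subset (m + (2 + (m + l)))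
  place U b a X = U ++ (b ∷ a ∷ (∅ ++ X))

  constructionRank : (L : Matroid l) (p q : Fin l) (N : Matroid m) (A : Subset m) → Subset m → Bool → Bool → Subset l → ℕ
  constructionRank L p q N A U b a X =
    minRank (r N full) (bit a + ∣ U ∩ A ∣) (bit b + ∣ U ∩ ∁ A ∣) (r N U)
            (r L X) (r L (X ∪ ⁅ p ⁆)) (r L (X ∪ ⁅ q ⁆)) (r L ((X ∪ ⁅ p ⁆) ∪ ⁅ q ⁆))

  -- The upper bound evaluates the choices `W = ∅` and `W = U`. The lower bound takes the `W`
  -- supplied by `copies-≥` and compares each of the four terms of `S2-rank` with one of the five.
  construction-rank : ∀ {L : Matroid l} {N : Matroid m} {p q A M₁} → IsBasis N A → IsBasis N (∁ A) →
    Construction L p q N A M₁ → ∀ U b a X → r M₁ (place U b a X) ≡ constructionRank L p q N A U b a X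
  construction-rank {L} {N} {p} {q} {A} {M₁} bA bB K U b a X = ≤-antisym upper lower
    where
    open Construction K
    R s t x P Q Z : ℕ
    R = r N full
    s = bit a + ∣ U ∩ A ∣
    t = bit b + ∣ U ∩ ∁ A ∣
    x = r L X
    P = r L (X ∪ ⁅ p ⁆)
    Q = r L (X ∪ ⁅ q ⁆)
    Z = r L ((X ∪ ⁅ p ⁆) ∪ ⁅ q ⁆)
    module G = MinRank R s t (r N U) x P Q Z

    S2r : Bool → Bool → Subset m → ℕ
    S2r b a Y = ((bit b + (bit a + (r N Y + x))) ⊓ (bit b + (R + P))) ⊓ ((bit a + (R + Q)) ⊓ (R + Z))

    filled : ∀ W → r S2 (fill A (allFin m) W (b ∷ a ∷ (∅ ++ X))) ≡ S2r (hit (∁ A) W b) (hit A W a) W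
    filled W = trans (cong (r S2) (trans (fill-≡ A (allFin m) W b a ∅ X) (cong (λ Y → hit (∁ A) W b ∷ hit A W a ∷ (Y ++ X)) (fillN-allFin W))))
                     (S2-rank K _ _ W X)

    s+t : s + t ≡ (bit b + bit a) + ∣ U ∣
    s+t = trans (solve 4 (λ a u b v → (a :+ u) :+ (b :+ v) := (b :+ a) :+ (u :+ v)) refl (bit a) (∣ U ∩ A ∣) (bit b) (∣ U ∩ ∁ A ∣))
                (cong ((bit b + bit a) +_) (∣X∩Y∣+∣X∩∁Y∣≡∣X∣ U A))

    bit≤1 : ∀ c → bit c ≤ 1
    bit≤1 false = z≤n
    bit≤1 true  = ≤-refl

    upper : r M₁ (place U b a X) ≤ minRank R s t (r N U) x P Q Z
    upper = G.glb first
      (≤-trans ≤S2 (≤-trans (≤-trans (m⊓n≤m _ _) (m⊓n≤m _ _))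
        (+-mono-≤ (bit≤1 b') (≤-trans (+-monoˡ-≤ _ (bit≤1 a')) (≤-reflexive (cong suc (+-comm (r N U) x)))))))
      (≤-trans ≤S2 (≤-trans (≤-trans (m⊓n≤m _ _) (m⊓n≤n (bit b' + (bit a' + (r N U + x))) _)) (+-monoˡ-≤ (R + P) (hit≤ (∁ A) U b))))
      (≤-trans ≤S2 (≤-trans (≤-trans (m⊓n≤n u _) (m⊓n≤m _ _)) (+-monoˡ-≤ (R + Q) (hit≤ A U a))))
      (≤-trans ≤S2 (≤-trans (m⊓n≤n u _) (m⊓n≤n (bit a' + (R + Q)) _)))
      where
      open ≤-Reasoning
      b' a' : Bool
      b' = hit (∁ A) U b
      a' = hit A U a
      u : ℕ
      u = (bit b' + (bit a' + (r N U + x))) ⊓ (bit b' + (R + P))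
      ≤S2 : r M₁ (place U b a X) ≤ S2r b' a' U
      ≤S2 = ≤-trans (copies-≤-fill copies U _) (≤-reflexive (filled U))
      first : r M₁ (place U b a X) ≤ x + (s + t)
      first = begin
        r M₁ (place U b a X)                       ≤⟨ copies-≤-card copies U _ ⟩
        ∣ U ∣ + r S2 (b ∷ a ∷ (∅ ++ X))            ≡⟨ cong (∣ U ∣ +_) (S2-rank K b a ∅ X) ⟩
        ∣ U ∣ + S2r b a ∅                          ≤⟨ +-monoʳ-≤ ∣ U ∣ (≤-trans (m⊓n≤m _ _) (m⊓n≤m _ _)) ⟩
        ∣ U ∣ + (bit b + (bit a + (r N ∅ + x)))    ≡⟨ cong (λ z → ∣ U ∣ + (bit b + (bit a + (z + x)))) (r-∅ N) ⟩
        ∣ U ∣ + (bit b + (bit a + x))              ≡⟨ solve 4 (λ u b a x → u :+ (b :+ (a :+ x)) := x :+ ((b :+ a) :+ u)) refl ∣ U ∣ (bit b) (bit a) x ⟩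
        x + ((bit b + bit a) + ∣ U ∣)              ≡⟨ cong (x +_) s+t ⟨
        x + (s + t)                                ∎

    lower : minRank R s t (r N U) x P Q Z ≤ r M₁ (place U b a X)
    lower with copies-≥ copies U (b ∷ a ∷ (∅ ++ X))
    ... | W , W' , U⊆ , le = ≤-trans bound (≤-trans (≤-reflexive (cong (∣ W' ∣ +_) (sym (filled W)))) le)
      where
      open ≤-Reasoning
      b' a' : Bool
      b' = hit (∁ A) W b
      a' = hit A W a

      independent : r N W ≡ ∣ W ∣ → minRank R s t (r N U) x P Q Z ≤ ∣ W' ∣ + (bit b' + (bit a' + (r N W + x)))
      independent eq = begin
        minRank R s t (r N U) x P Q Z                  ≤⟨ G.≤₁ ⟩
        x + (s + t)                                    ≡⟨ cong (x +_) s+t ⟩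
        x + ((bit b + bit a) + ∣ U ∣)                  ≤⟨ +-monoʳ-≤ x (+-mono-≤ (+-mono-≤ (bit≤hit (∁ A) W b) (bit≤hit A W a))
                                                            (≤-trans (p⊆q⇒∣p∣≤∣q∣ U⊆) (∣X∪Y∣≤∣X∣+∣Y∣ W W'))) ⟩
        x + ((bit b' + bit a') + (∣ W ∣ + ∣ W' ∣))     ≡⟨ cong (λ z → x + ((bit b' + bit a') + (z + ∣ W' ∣))) eq ⟨
        x + ((bit b' + bit a') + (r N W + ∣ W' ∣))     ≡⟨ solve 5 (λ x b a w v → x :+ ((b :+ a) :+ (w :+ v)) := v :+ (b :+ (a :+ (w :+ x)))) refl
                                                            x (bit b') (bit a') (r N W) ∣ W' ∣ ⟩
        ∣ W' ∣ + (bit b' + (bit a' + (r N W + x)))     ∎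

      first : minRank R s t (r N U) x P Q Z ≤ ∣ W' ∣ + (bit b' + (bit a' + (r N W + x)))
      first with nonempty? (W ∩ A) | nonempty? (W ∩ ∁ A)
      -- `W` misses one of the two bases, hence lies in the other one and is independent.
      ... | no none | _ = independent (basis-indep N bB (λ {e} e∈W → x∉p⇒x∈∁p (λ e∈A → none (e , x∈p∩q⁺ (e∈W , e∈A)))))
      ... | yes _ | no none = independent (basis-indep N bA (λ {e} e∈W → x∉∁p⇒x∈p (λ e∈B → none (e , x∈p∩q⁺ (e∈W , e∈B)))))
      -- `W` meets both bases, so both bits are 1; together they form the 2 of the second term.
      ... | yes (i , i∈) | yes (j , j∈)
        rewrite hit-∈ A a (proj₁ (x∈p∩q⁻ W A i∈)) (proj₂ (x∈p∩q⁻ W A i∈))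
              | hit-∈ (∁ A) b (proj₁ (x∈p∩q⁻ W (∁ A) j∈)) (proj₂ (x∈p∩q⁻ W (∁ A) j∈)) = begin
        minRank R s t (r N U) x P Q Z     ≤⟨ G.≤₂ ⟩
        2 + (x + r N U)                   ≤⟨ +-monoʳ-≤ (2 + x) (≤-trans (r-mono N U⊆) (r-∪-card N W W')) ⟩
        2 + (x + (r N W + ∣ W' ∣))        ≡⟨ solve 3 (λ x w v → con 2 :+ (x :+ (w :+ v)) := v :+ (con 1 :+ (con 1 :+ (w :+ x)))) refl x (r N W) ∣ W' ∣ ⟩
        ∣ W' ∣ + (1 + (1 + (r N W + x)))  ∎

      second : minRank R s t (r N U) x P Q Z ≤ ∣ W' ∣ + (bit b' + (R + P))
      second = ≤-trans G.≤₃ (≤-trans (+-monoˡ-≤ (R + P) (≤hit (∁ A) b U⊆)) (≤-reflexive (+-assoc ∣ W' ∣ (bit b') _)))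

      third : minRank R s t (r N U) x P Q Z ≤ ∣ W' ∣ + (bit a' + (R + Q))
      third = ≤-trans G.≤₄ (≤-trans (+-monoˡ-≤ (R + Q) (≤hit A a U⊆)) (≤-reflexive (+-assoc ∣ W' ∣ (bit a') _)))

      bound : minRank R s t (r N U) x P Q Z ≤ ∣ W' ∣ + S2r b' a' W
      bound = begin
        minRank R s t (r N U) x P Q Z
          ≤⟨ ⊓-glb (⊓-glb first second) (⊓-glb third (≤-trans G.≤₅ (m≤n+m (R + Z) ∣ W' ∣))) ⟩
        ((∣ W' ∣ + (bit b' + (bit a' + (r N W + x)))) ⊓ (∣ W' ∣ + (bit b' + (R + P)))) ⊓ ((∣ W' ∣ + (bit a' + (R + Q))) ⊓ (∣ W' ∣ + (R + Z)))
          ≡⟨ cong₂ _⊓_ (+-distribˡ-⊓ ∣ W' ∣ _ _) (+-distribˡ-⊓ ∣ W' ∣ _ _) ⟨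
        (∣ W' ∣ + ((bit b' + (bit a' + (r N W + x))) ⊓ (bit b' + (R + P)))) ⊓ (∣ W' ∣ + ((bit a' + (R + Q)) ⊓ (R + Z)))
          ≡⟨ +-distribˡ-⊓ ∣ W' ∣ _ _ ⟨
        ∣ W' ∣ + S2r b' a' W ∎

-- Moving one element of the ground set to the front

module _ {n} (e : Fin (suc n)) where

  -- Extensions put the new element at `zero`; pulling back along this bijection returns it to
  -- position `e`.
  toFront : Fin (suc n) → Fin (suc n)
  toFront j with e ≟ᶠ j
  ... | yes _  = zero
  ... | no e≢j = suc (punchOut e≢j)

  toFront-self : toFront e ≡ zero
  toFront-self with e ≟ᶠ e
  ... | yes _  = refl
  ... | no e≢e = contradiction refl e≢e

  toFront-punchIn : ∀ i → toFront (punchIn e i) ≡ suc i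
  toFront-punchIn i with e ≟ᶠ punchIn e i
  ... | yes eq = contradiction (sym eq) (punchInᵢ≢i e i)
  ... | no e≢j = cong suc (trans (punchOut-cong e refl) (punchOut-punchIn e))

  toFront-suc : ∀ {j i} → toFront j ≡ suc i → j ≡ punchIn e i
  toFront-suc {j} eq with e ≟ᶠ j
  toFront-suc refl | no e≢j = sym (punchIn-punchOut e≢j)

  toFront-zero : ∀ {j} → toFront j ≡ zero → j ≡ e
  toFront-zero {j} eq with e ≟ᶠ j
  ... | yes refl = refl

  toFront-injective : Injective _≡_ _≡_ toFront
  toFront-injective {i} {j} eq with toFront j in eqj
  ... | zero  = trans (toFront-zero eq) (sym (toFront-zero eqj))
  ... | suc _ = trans (toFront-suc eq) (sym (toFront-suc eqj))

  toFront-surjective : ∀ j → ∃ λ i → toFront i ≡ j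
  toFront-surjective zero    = e , toFront-self
  toFront-surjective (suc j) = punchIn e j , toFront-punchIn j

-- Natural classes

module _ {𝓜 : Class} (nat : Natural 𝓜) where
  open Natural nat

  principalExt-closed : ∀ {n} (M : Matroid n) G → 𝓜 M → 𝓜 (principalExt M (cl M G))
  principalExt-closed M G = principal-closed M (cl M G) _ (cl-flat M G) (principalExt-isPrincipal M (cl M G))

  buildCopies : ∀ {m l} A {S2 : Matroid (2 + (m + l))} → 𝓜 S2 → ∀ {k} (xs : Vec (Fin m) k) →
                ∃ λ K → Copies A S2 xs K × 𝓜 K
  buildCopies A S2∈ []       = _ , done , S2∈
  buildCopies A S2∈ {suc k} (x ∷ xs) with buildCopies A S2∈ xs
  ... | K , c , K∈ = _ , step x c (principalExt-isPrincipal K _) , principalExt-closed K (⁅ k ↑ʳ pos2N x ⁆ ∪ ⁅ k ↑ʳ partner A x ⁆) K∈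

  -- Some instance suffices, since `construction-rank` holds for every `Construction`; naturality
  -- puts this one in the class.
  build : ∀ {m l} {L : Matroid l} {N : Matroid m} p q A → 𝓜 L → 𝓜 N → ∃ λ M₁ → Construction L p q N A M₁ × 𝓜 M₁
  build {m} {l} {L} {N} p q A L∈ N∈ =
    let S0∈ = sum-closed N L _ (directSum-isDirectSum N L) N∈ L∈
        S1∈ = principalExt-closed (directSum N L) (elemsN {m} {l} ∪ ⁅ posL {m} {l} p ⁆) S0∈
        S2∈ = principalExt-closed _ (false ∷ (elemsN {m} {l} ∪ ⁅ posL {m} {l} q ⁆)) S1∈
        M₁ , c , M₁∈ = buildCopies A S2∈ (allFin m)
    in M₁ , record { sum = directSum-isDirectSum N L ; addA = principalExt-isPrincipal _ _
                   ; addB = principalExt-isPrincipal _ _ ; copies = c } , M₁∈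

  -- Instead of shrinking the ground set of L, remove e and put it back as a loop.
  replaceByLoop : ∀ {l} {L : Matroid l} (e : Fin l) {C D} → C ⊆ ⁅ e ⁆ → D ⊆ ⁅ e ⁆ → e ∈ C ⊎ e ∈ D →
                  (∀ x → x ∈ C → x ∈ D → ⊥) →
                  (∀ {k} (K : Matroid k) → IsProperMinor L K → 𝓜 K) →
                  ∃ λ L' → 𝓜 L' × (∀ X → r L (X ∩ ∁ ⁅ e ⁆ ∪ C) ≡ r L' X + r L C)
  replaceByLoop {suc l} {L} e {C} {D} C⊆ D⊆ e∈ disj minors = L' , L'∈ , rank
    where
    open ≡-Reasoning
    K : Matroid l
    K = pullback L C (punchIn e)
    K⁺ : Matroid (suc l)
    -- An element placed freely in the closure of the empty set is a loop.
    K⁺ = principalExt K (cl K ∅)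
    L' : Matroid (suc l)
    L' = pullback K⁺ ∅ (toFront e)

    avoid : ∀ {i E} → E ⊆ ⁅ e ⁆ → punchIn e i ∉ E
    avoid {i} E⊆ i∈ = punchInᵢ≢i e i (x∈⁅y⁆⇒x≡y e (E⊆ i∈))

    onto : ∀ x → x ∉ C → x ∉ D → ∃ λ i → punchIn e i ≡ x
    onto x x∉C x∉D with e ≟ᶠ x
    ... | yes refl = ⊥-elim ([ x∉C , x∉D ]′ e∈)
    ... | no e≢x   = punchOut e≢x , punchIn-punchOut e≢x

    K∈ : 𝓜 K
    K∈ = minors K (C , D , punchIn e , record
      { disjoint = disj ; f-inj = λ {i} {j} → punchIn-injective e i j ; f-avoid = λ i → avoid C⊆ , avoid D⊆
      ; f-onto = onto ; rank = pullback-rank L C (punchIn e) } , e , e∈)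

    L'∈ : 𝓜 L'
    L'∈ = iso-closed K⁺ L' (toFront e , record
      { disjoint = λ _ x∈∅ → ⊥-elim (∉⊥ x∈∅) ; f-inj = toFront-injective e ; f-avoid = λ _ → ∉⊥ , ∉⊥
      ; f-onto = λ x _ _ → toFront-surjective e x ; rank = pullback-rank K⁺ ∅ (toFront e) })
      (principalExt-closed K ∅ K∈)

    K⁺-rank : ∀ b T → r K⁺ (b ∷ T) ≡ r K T
    K⁺-rank false T = refl
    K⁺-rank true  T = begin
      suc (r K T) ⊓ r K (T ∪ cl K ∅)  ≡⟨ cong (suc (r K T) ⊓_) (trans (r-∪-cl K T ∅) (cong (r K) (∪-identityʳ T))) ⟩
      suc (r K T) ⊓ r K T             ≡⟨ m≥n⇒m⊓n≡n (n≤1+n _) ⟩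
      r K T                           ∎

    restrict : ∀ X b T → image (toFront e) X ≡ b ∷ T → X ∩ ∁ ⁅ e ⁆ ≡ image (punchIn e) T
    restrict X b T eq = ⊆-antisym ⇒ ⇐
      where
      ⇒ : X ∩ ∁ ⁅ e ⁆ ⊆ image (punchIn e) T
      ⇒ {x} x∈ with x∈p∩q⁻ X (∁ ⁅ e ⁆) x∈
      ... | x∈X , x∈∁e with e ≟ᶠ x
      ...   | yes refl = contradiction (x∈⁅x⁆ e) (x∈∁p⇒x∉p x∈∁e)
      ...   | no e≢x   = subst (_∈ image (punchIn e) T) (punchIn-punchOut e≢x) (∈-image⁺ (punchIn e)
        (drop-there (subst (suc (punchOut e≢x) ∈_) eq (subst (_∈ image (toFront e) X)
          (trans (cong (toFront e) (sym (punchIn-punchOut e≢x))) (toFront-punchIn e _)) (∈-image⁺ (toFront e) x∈X)))))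
      ⇐ : image (punchIn e) T ⊆ X ∩ ∁ ⁅ e ⁆
      ⇐ x∈ with ∈-image⁻ (punchIn e) T x∈
      ... | i , i∈T , refl with ∈-image⁻ (toFront e) X (subst (suc i ∈_) (sym eq) (there i∈T))
      ...   | j , j∈X , eq' = x∈p∩q⁺ (subst (_∈ X) (toFront-suc e eq') j∈X , x∉p⇒x∈∁p (punchInᵢ≢i e i ∘ x∈⁅y⁆⇒x≡y e))

    rank : ∀ X → r L (X ∩ ∁ ⁅ e ⁆ ∪ C) ≡ r L' X + r L C
    rank X = go (image (toFront e) X) refl
      where
      go : ∀ Y → image (toFront e) X ≡ Y → r L (X ∩ ∁ ⁅ e ⁆ ∪ C) ≡ r L' X + r L C
      go (b ∷ T) eq = begin
        r L (X ∩ ∁ ⁅ e ⁆ ∪ C)                    ≡⟨ cong (λ Y → r L (Y ∪ C)) (restrict X b T eq) ⟩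
        r L (image (punchIn e) T ∪ C)            ≡⟨ pullback-rank L C (punchIn e) T ⟨
        r K T + r L C                            ≡⟨ cong (_+ r L C) (K⁺-rank b T) ⟨
        r K⁺ (b ∷ T) + r L C                     ≡⟨ cong (λ Y → r K⁺ Y + r L C) (trans (∪-identityʳ _) eq) ⟨
        r K⁺ (image (toFront e) X ∪ ∅) + r L C   ≡⟨ cong (_+ r L C) (pullback-rank K⁺ ∅ (toFront e) X) ⟨
        r L' X + r K⁺ ∅ + r L C                  ≡⟨ cong (λ z → r L' X + z + r L C) (r-∅ K⁺) ⟩
        r L' X + 0 + r L C                       ≡⟨ cong (_+ r L C) (+-identityʳ (r L' X)) ⟩
        r L' X + r L C                           ∎

-- Redirected matroids

module _ {l} {L : Matroid l} {u v : Fin l} {K : Matroid l} (red : Redirected L u v K) where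

  private
    K' : Matroid (suc l)
    K' = proj₁ red
    E = proj₁ (proj₂ red)

    rank-image : ∀ X → r K X ≡ r K' (image (redirect u) X)
    rank-image X = begin
      r K X                              ≡⟨ +-identityʳ (r K X) ⟨
      r K X + 0                          ≡⟨ cong (r K X +_) (r-∅ K') ⟨
      r K X + r K' ∅                     ≡⟨ MinorVia.rank (proj₂ (proj₂ red)) X ⟩
      r K' (image (redirect u) X ∪ ∅)    ≡⟨ cong (r K') (∪-identityʳ _) ⟩
      r K' (image (redirect u) X)        ∎
      where open ≡-Reasoning

    redirect-≢ : ∀ {e} → e ≢ u → redirect u e ≡ suc e
    redirect-≢ {e} e≢u with e ≟ᶠ u
    ... | yes e≡u = contradiction e≡u e≢u
    ... | no _    = refl

    redirect-self : redirect u u ≡ zero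
    redirect-self with u ≟ᶠ u
    ... | yes _  = refl
    ... | no u≢u = contradiction refl u≢u

    image-∉ : ∀ {X} → u ∉ X → image (redirect u) X ≡ false ∷ X
    image-∉ {X} u∉X = ⊆-antisym ⇒ ⇐
      where
      ≢u : ∀ {i} → i ∈ X → i ≢ u
      ≢u i∈X refl = u∉X i∈X
      ⇒ : image (redirect u) X ⊆ false ∷ X
      ⇒ e∈ with ∈-image⁻ (redirect u) X e∈
      ... | i , i∈X , refl = subst (_∈ false ∷ X) (sym (redirect-≢ (≢u i∈X))) (there i∈X)
      ⇐ : false ∷ X ⊆ image (redirect u) X
      ⇐ (there i∈X) = subst (_∈ image (redirect u) X) (redirect-≢ (≢u i∈X)) (∈-image⁺ (redirect u) i∈X)

    image-∈ : ∀ {X} → u ∉ X → image (redirect u) (X ∪ ⁅ u ⁆) ≡ true ∷ X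
    image-∈ {X} u∉X = begin
      image (redirect u) (X ∪ ⁅ u ⁆)                       ≡⟨ image-∪ (redirect u) X ⁅ u ⁆ ⟩
      image (redirect u) X ∪ image (redirect u) ⁅ u ⁆      ≡⟨ cong₂ _∪_ (image-∉ u∉X) (⊆-antisym ⇒ ⇐) ⟩
      (false ∷ X) ∪ ⁅ zero ⁆                               ≡⟨ cong (true ∷_) (∪-identityʳ X) ⟩
      true ∷ X                                             ∎
      where
      open ≡-Reasoning
      ⇒ : image (redirect u) ⁅ u ⁆ ⊆ ⁅ zero ⁆
      ⇒ e∈ with ∈-image⁻ (redirect u) ⁅ u ⁆ e∈
      ... | i , i∈u , refl rewrite x∈⁅y⁆⇒x≡y u i∈u | redirect-self = here
      ⇐ : ⁅ zero ⁆ ⊆ image (redirect u) ⁅ u ⁆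
      ⇐ = ⁅⁆⊆ (subst (_∈ image (redirect u) ⁅ u ⁆) redirect-self (∈-image⁺ (redirect u) (x∈⁅x⁆ u)))

  redirected-∉ : ∀ {X} → u ∉ X → r K X ≡ r L X
  redirected-∉ {X} u∉X = trans (rank-image X) (trans (cong (r K') (image-∉ u∉X)) (PrincipalExt.deletion E X))

  redirected-∈ : ∀ {X} → u ∉ X → r K (X ∪ ⁅ u ⁆) ≡ suc (r L X) ⊓ r L ((X ∪ ⁅ u ⁆) ∪ ⁅ v ⁆)
  redirected-∈ {X} u∉X = begin
    r K (X ∪ ⁅ u ⁆)                                 ≡⟨ rank-image _ ⟩
    r K' (image (redirect u) (X ∪ ⁅ u ⁆))           ≡⟨ cong (r K') (image-∈ u∉X) ⟩
    r K' (true ∷ X)                                 ≡⟨ principal-rank-cl E X ⟩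
    suc (r L X) ⊓ r L (X ∪ (⁅ u ⁆ ∪ ⁅ v ⁆))         ≡⟨ cong (λ Y → suc (r L X) ⊓ r L Y) (∪-assoc X ⁅ u ⁆ ⁅ v ⁆) ⟨
    suc (r L X) ⊓ r L ((X ∪ ⁅ u ⁆) ∪ ⁅ v ⁆)         ∎
    where open ≡-Reasoning

  -- Once `v` is present, `u` adds at most one to the rank, and the freely placed element adds just
  -- as much. Hence redirection leaves the rank `Z` of `X ∪ {p, q}` unchanged.
  redirected-both : ∀ {X} → u ≢ v → u ∉ X → r K ((X ∪ ⁅ v ⁆) ∪ ⁅ u ⁆) ≡ r L ((X ∪ ⁅ v ⁆) ∪ ⁅ u ⁆)
  redirected-both {X} u≢v u∉X = trans (redirected-∈ (∉-∪⁅⁆ u∉X u≢v))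
    (trans (cong (λ Y → suc (r L (X ∪ ⁅ v ⁆)) ⊓ r L Y) absorb) (m≥n⇒m⊓n≡n (r-∪⁅⁆ L (X ∪ ⁅ v ⁆) u)))
    where
    absorb : ((X ∪ ⁅ v ⁆) ∪ ⁅ u ⁆) ∪ ⁅ v ⁆ ≡ (X ∪ ⁅ v ⁆) ∪ ⁅ u ⁆
    absorb = trans (∪-swapʳ (X ∪ ⁅ v ⁆) ⁅ u ⁆ ⁅ v ⁆)
      (cong (_∪ ⁅ u ⁆) (trans (∪-assoc X ⁅ v ⁆ ⁅ v ⁆) (cong (X ∪_) (∪-idem ⁅ v ⁆))))

-- Comparing the constructions for L and for a redirection or one-element minor of L

module _ {m l : ℕ} where

  data Position : Fin (m + (2 + (m + l))) → Set where
    copy : ∀ (i : Fin m) → Position (i ↑ˡ (2 + (m + l)))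
    at-b : Position (m ↑ʳ pos2b {m} {l})
    at-a : Position (m ↑ʳ pos2a {m} {l})
    at-N : ∀ i → Position (m ↑ʳ pos2N {m} {l} i)
    at-L : ∀ u → Position (m ↑ʳ suc (suc (posL {m} {l} u)))

  position : ∀ e → Position e
  position e with splitAt m e | join-splitAt m (2 + (m + l)) e
  ... | inj₁ i             | refl = copy i
  ... | inj₂ zero          | refl = at-b
  ... | inj₂ (suc zero)    | refl = at-a
  ... | inj₂ (suc (suc j)) | refl with splitAt m j | join-splitAt m l j
  ...   | inj₁ i | refl = at-N i
  ...   | inj₂ u | refl = at-L u

  module _ {p q : Fin l} where

    old∈deleted : ∀ {j : Fin (m + l)} → j ∈ elemsN {m} {l} ∪ ⁅ posL {m} {l} p ⁆ ∪ ⁅ posL {m} {l} q ⁆ →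
                  m ↑ʳ suc (suc j) ∈ deleted {m} {l} p q
    old∈deleted j∈ = ∈-++⁺ʳ (∅ {m}) (there (there j∈))

    N∈deleted : ∀ i → m ↑ʳ pos2N {m} {l} i ∈ deleted p q
    N∈deleted i = old∈deleted (p⊆p∪q _ (∈-++⁺ˡ {X = full} {∅} (∈⊤ {x = i})))

    p∈deleted : m ↑ʳ suc (suc (posL {m} {l} p)) ∈ deleted p q
    p∈deleted = old∈deleted (q⊆p∪q (elemsN {m} {l}) _ (p⊆p∪q _ (x∈⁅x⁆ (posL p))))

    q∈deleted : m ↑ʳ suc (suc (posL {m} {l} q)) ∈ deleted p q
    q∈deleted = old∈deleted (q⊆p∪q (elemsN {m} {l}) _ (q⊆p∪q ⁅ posL p ⁆ _ (x∈⁅x⁆ (posL q))))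

    L∈place : ∀ {U b a} {X : Subset l} {u} → u ∈ X → m ↑ʳ suc (suc (posL u)) ∈ place U b a X
    L∈place {U} u∈X = ∈-++⁺ʳ U (there (there (∈-++⁺ʳ (∅ {m}) u∈X)))

    avoiding-deleted : ∀ Y → (∀ {e} → e ∈ Y → e ∉ deleted {m} {l} p q) →
                       ∃₂ λ U b → ∃₂ λ a X → Y ≡ place U b a X × p ∉ X × q ∉ X
    avoiding-deleted Y avoid with Data.Vec.splitAt m Y
    ... | U , b ∷ a ∷ V , refl with Data.Vec.splitAt m V
    ...   | T , X , refl with Empty-unique {p = T} (λ (i , i∈T) → avoid (∈-++⁺ʳ U (there (there (∈-++⁺ˡ i∈T)))) (N∈deleted i))
    ...     | refl = U , b , a , X , refl , (λ p∈X → avoid (L∈place p∈X) p∈deleted) , (λ q∈X → avoid (L∈place q∈X) q∈deleted)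

module _ {𝓜 : Class} (nat : Natural 𝓜) {l m} (L : Matroid l) (N : Matroid m) (p q : Fin l) (A : Subset m)
         (bA : IsBasis N A) (bB : IsBasis N (∁ A)) (N∈ : 𝓜 N)
         {M₁ : Matroid (m + (2 + (m + l)))} (cM₁ : Construction L p q N A M₁)
         {j} {K : Matroid j} {C D f} (V : MinorVia M₁ K C D f) (deleted⊆D : deleted p q ⊆ D) where

  SameRanks : Matroid l → ℕ → Set
  SameRanks L' c = ∀ U b a X → p ∉ X → q ∉ X → C ⊆ place U b a X → (∀ {e} → e ∈ place U b a X → e ∉ D) →
                   constructionRank L p q N A U b a X ≡ constructionRank L' p q N A U b a X + c

  minor-of-replacement : ∀ {L' M₁'} → Construction L' p q N A M₁' → 𝓜 M₁' → ∀ c → SameRanks L' c → 𝓜 K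
  minor-of-replacement {L'} {M₁'} cM₁' M₁'∈ c same =
    Natural.minor-closed nat M₁' K (C , D , f , minorVia-transfer c ranks V) M₁'∈
    where
    ranks : ∀ Y → C ⊆ Y → (∀ {e} → e ∈ Y → e ∉ D) → r M₁ Y ≡ r M₁' Y + c
    ranks Y C⊆Y avoid with avoiding-deleted Y (λ e∈Y → avoid e∈Y ∘ deleted⊆D)
    ... | U , b , a , X , refl , p∉X , q∉X = begin
      r M₁ (place U b a X)                        ≡⟨ construction-rank bA bB cM₁ U b a X ⟩
      constructionRank L p q N A U b a X          ≡⟨ same U b a X p∉X q∉X C⊆Y avoid ⟩
      constructionRank L' p q N A U b a X + c     ≡⟨ cong (_+ c) (construction-rank bA bB cM₁' U b a X) ⟨
      r M₁' (place U b a X) + c                   ∎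
      where open ≡-Reasoning

  replaceL : ∀ {L'} → 𝓜 L' → ∀ c → SameRanks L' c → 𝓜 K
  replaceL L'∈ = let _ , cM₁' , M₁'∈ = build nat p q A L'∈ N∈ in minor-of-replacement cM₁' M₁'∈

  module _ {e} (e∈ : e ∈ C ⊎ e ∈ D) where

    element-of-L : (∀ {k} (K : Matroid k) → IsProperMinor L K → 𝓜 K) →
                   ∀ u → e ≡ m ↑ʳ suc (suc (posL {m} {l} u)) → u ≢ p → u ≢ q → 𝓜 K
    element-of-L minors u refl u≢p u≢q = [ contract , delete ]′ e∈
      where
      -- All four sets whose rank in `L` enters lie between `X` and `X ∪ {p, q}`. If `u` is
      -- contracted, they all contain `u`; if it is deleted, `u ≢ p` and `u ≢ q` keep it out of all
      -- of them.
      shift : ∀ L' c U b a X → (∀ Y → X ⊆ Y → Y ⊆ (X ∪ ⁅ p ⁆) ∪ ⁅ q ⁆ → r L Y ≡ r L' Y + c) →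
              constructionRank L p q N A U b a X ≡ constructionRank L' p q N A U b a X + c
      shift L' c U b a X eq
        rewrite eq X ⊆-refl (⊆-∪ˡ {X = X} ⁅ q ⁆ (p⊆p∪q ⁅ p ⁆))
              | eq (X ∪ ⁅ p ⁆) (p⊆p∪q _) (p⊆p∪q _)
              | eq (X ∪ ⁅ q ⁆) (p⊆p∪q _) (∪-monoˡ-⊆ ⁅ q ⁆ (p⊆p∪q _))
              | eq ((X ∪ ⁅ p ⁆) ∪ ⁅ q ⁆) (⊆-∪ˡ {X = X} ⁅ q ⁆ (p⊆p∪q ⁅ p ⁆)) ⊆-refl =
        minRank-shift (r N full) (bit a + ∣ U ∩ A ∣) (bit b + ∣ U ∩ ∁ A ∣) (r N U) _ _ _ _ c
      contract : e ∈ C → 𝓜 K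
      contract e∈C with replaceByLoop nat {L = L} u {⁅ u ⁆} {∅} ⊆-refl ⊥⊆ (inj₁ (x∈⁅x⁆ u)) (λ _ _ → ∉⊥) minors
      ... | L' , L'∈ , rank = replaceL L'∈ (r L ⁅ u ⁆) λ U b a X _ _ C⊆ _ →
        shift L' _ U b a X λ Y X⊆Y _ → trans (cong (r L) (restore Y (X⊆Y
          (∈-++⁻ʳ (∅ {m}) (drop-there (drop-there (∈-++⁻ʳ U (C⊆ e∈C)))))))) (rank Y)
        where
        restore : ∀ Y → u ∈ Y → Y ≡ Y ∩ ∁ ⁅ u ⁆ ∪ ⁅ u ⁆
        restore Y u∈Y = ⊆-antisym ⇒ (∪-lub {X = Y ∩ ∁ ⁅ u ⁆} (p∩q⊆p Y _) (⁅⁆⊆ u∈Y))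
          where
          ⇒ : Y ⊆ Y ∩ ∁ ⁅ u ⁆ ∪ ⁅ u ⁆
          ⇒ {x} x∈Y with x ∈? ⁅ u ⁆
          ... | yes x∈u = q⊆p∪q (Y ∩ ∁ ⁅ u ⁆) _ x∈u
          ... | no x∉u  = p⊆p∪q _ (x∈p∩q⁺ (x∈Y , x∉p⇒x∈∁p x∉u))
      delete : e ∈ D → 𝓜 K
      delete e∈D with replaceByLoop nat {L = L} u {∅} {⁅ u ⁆} ⊥⊆ ⊆-refl (inj₂ (x∈⁅x⁆ u)) (λ _ x∈∅ _ → ∉⊥ x∈∅) minors
      ... | L' , L'∈ , rank = replaceL L'∈ (r L ∅) λ U b a X _ _ _ avoid →
        shift L' _ U b a X λ Y _ Y⊆ → trans (cong (r L) (restore Y (λ u∈Y →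
          ∉-∪⁅⁆ (∉-∪⁅⁆ (λ u∈X → avoid (L∈place {p = p} {q} {U} u∈X) e∈D) u≢p) u≢q (Y⊆ u∈Y)))) (rank Y)
        where
        restore : ∀ Y → u ∉ Y → Y ≡ Y ∩ ∁ ⁅ u ⁆ ∪ ∅
        restore Y u∉Y = sym (trans (∪-identityʳ _) (⊆-antisym (p∩q⊆p Y _)
          (λ {x} x∈Y → x∈p∩q⁺ (x∈Y , x∉p⇒x∈∁p (λ x∈u → u∉Y (subst (_∈ Y) (x∈⁅y⁆⇒x≡y u x∈u) x∈Y))))))

    module _ (p≢q : p ≢ q) {Kpq Kqp : Matroid l} (pq : Redirected L p q Kpq) (qp : Redirected L q p Kqp)
             (Kpq∈ : 𝓜 Kpq) (Kqp∈ : 𝓜 Kqp) where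

      private
        R : ℕ
        R = r N full
        module _ (U : Subset m) (b a : Bool) (X : Subset l) where
          s t n x P Q Z : ℕ
          s = bit a + ∣ U ∩ A ∣
          t = bit b + ∣ U ∩ ∁ A ∣
          n = r N U
          x = r L X
          P = r L (X ∪ ⁅ p ⁆)
          Q = r L (X ∪ ⁅ q ⁆)
          Z = r L ((X ∪ ⁅ p ⁆) ∪ ⁅ q ⁆)

          Q≤Z : Q ≤ Z
          Q≤Z = r-mono L (∪-monoˡ-⊆ ⁅ q ⁆ (p⊆p∪q _))

          Z≤1+Q : Z ≤ suc Q
          Z≤1+Q = ≤-trans (≤-reflexive (cong (r L) (∪-swapʳ X ⁅ p ⁆ ⁅ q ⁆))) (r-∪⁅⁆ L (X ∪ ⁅ q ⁆) p)

          rank-pq : p ∉ X → constructionRank Kpq p q N A U b a X ≡ minRank R s t n x (suc x ⊓ Z) Q Z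
          rank-pq p∉X
            rewrite redirected-∉ pq p∉X | redirected-∈ pq p∉X | redirected-∉ pq (∉-∪⁅⁆ {f = q} p∉X p≢q)
                  | ∪-swapʳ X ⁅ p ⁆ ⁅ q ⁆ | redirected-both pq p≢q p∉X = refl

          rank-qp : q ∉ X → constructionRank Kqp p q N A U b a X ≡ minRank R s t n x P (suc x ⊓ Z) Z
          rank-qp q∉X
            rewrite redirected-∉ qp q∉X | redirected-∈ qp q∉X | redirected-∉ qp (∉-∪⁅⁆ {f = p} q∉X (p≢q ∘ sym))
                  | redirected-both qp (p≢q ∘ sym) q∉X | ∪-swapʳ X ⁅ q ⁆ ⁅ p ⁆ = refl

          deleteA : p ∉ X → s ≤ R → constructionRank L p q N A U b a X ≡ constructionRank Kpq p q N A U b a X + 0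
          deleteA p∉X s≤R = trans (minRank-delete R s t n x P Q Z s≤R (r-≤∪ L X _) (r-∪⁅⁆ L X p) (r-≤∪ L (X ∪ ⁅ p ⁆) _) (r-∪⁅⁆ L (X ∪ ⁅ p ⁆) q))
            (trans (sym (rank-pq p∉X)) (sym (+-identityʳ _)))

          -- `minRank-swap` exchanges the two sides, and with them the two redirections.
          deleteB : q ∉ X → t ≤ R → constructionRank L p q N A U b a X ≡ constructionRank Kqp p q N A U b a X + 0
          deleteB q∉X t≤R = trans (minRank-swap R s t n x P Q Z)
            (trans (minRank-delete R t s n x Q P Z t≤R (r-≤∪ L X _) (r-∪⁅⁆ L X q) Q≤Z Z≤1+Q)
              (trans (minRank-swap R t s n x (suc x ⊓ Z) P Z) (trans (sym (rank-qp q∉X)) (sym (+-identityʳ _)))))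

          contractA : q ∉ X → 1 ≤ s → constructionRank L p q N A U b a X ≡ constructionRank Kqp p q N A U b a X + 0
          contractA q∉X 1≤s = trans (minRank-contract R s t n x P Q Z 1≤s (r-∪⁅⁆ L X q) Q≤Z Z≤1+Q)
            (trans (sym (rank-qp q∉X)) (sym (+-identityʳ _)))

          contractB : p ∉ X → 1 ≤ t → constructionRank L p q N A U b a X ≡ constructionRank Kpq p q N A U b a X + 0
          contractB p∉X 1≤t = trans (minRank-swap R s t n x P Q Z)
            (trans (minRank-contract R t s n x Q P Z 1≤t (r-∪⁅⁆ L X p) (r-≤∪ L (X ∪ ⁅ p ⁆) _) (r-∪⁅⁆ L (X ∪ ⁅ p ⁆) q))
              (trans (minRank-swap R t s n x Q (suc x ⊓ Z) Z) (trans (sym (rank-pq p∉X)) (sym (+-identityʳ _)))))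

      -- Deletion and contraction on the same side call for opposite redirections. Otherwise the
      -- element matters only through a bound on `s`: every relevant set contains it if it is
      -- contracted and omits it if it is deleted.
      sideA : (∀ U b a X → e ∈ place U b a X → 1 ≤ bit a + ∣ U ∩ A ∣) →
              (∀ U b a X → e ∉ place U b a X → bit a + ∣ U ∩ A ∣ ≤ r N full) → 𝓜 K
      sideA present absent = [ (λ e∈C → replaceL Kqp∈ 0 λ U b a X _ q∉X C⊆ _ → contractA U b a X q∉X (present U b a X (C⊆ e∈C)))
                             , (λ e∈D → replaceL Kpq∈ 0 λ U b a X p∉X _ _ avoid → deleteA U b a X p∉X (absent U b a X (λ e∈Y → avoid e∈Y e∈D))) ]′ e∈

      sideB : (∀ U b a X → e ∈ place U b a X → 1 ≤ bit b + ∣ U ∩ ∁ A ∣) →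
              (∀ U b a X → e ∉ place U b a X → bit b + ∣ U ∩ ∁ A ∣ ≤ r N full) → 𝓜 K
      sideB present absent = [ (λ e∈C → replaceL Kpq∈ 0 λ U b a X p∉X _ C⊆ _ → contractB U b a X p∉X (present U b a X (C⊆ e∈C)))
                             , (λ e∈D → replaceL Kqp∈ 0 λ U b a X _ q∉X _ avoid → deleteB U b a X q∉X (absent U b a X (λ e∈Y → avoid e∈Y e∈D))) ]′ e∈

-- Bounds for s and t, and the case distinction on the removed element

copy-present : ∀ {m} {S : Subset m} {i} U c → i ∈ S → i ∈ U → 1 ≤ bit c + ∣ U ∩ S ∣
copy-present {S = S} U c i∈S i∈U = ≤-trans (∈⇒1≤∣∣ (x∈p∩q⁺ {p = U} {S} (i∈U , i∈S))) (m≤n+m _ (bit c))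

module _ {m} (N : Matroid m) {S : Subset m} where

  basis-size : IsBasis N S → ∣ S ∣ ≡ r N full
  basis-size (rS≡∣S∣ , rS≡r) = trans (sym rS≡∣S∣) rS≡r

  -- The missing copy leaves at most `r(N) - 1` elements of the basis `S` in `U`, which makes room
  -- for `a` or `b`.
  copy-absent : ∀ {i} U c → IsBasis N S → i ∈ S → i ∉ U → bit c + ∣ U ∩ S ∣ ≤ r N full
  copy-absent {i} U c bS i∈S i∉U = ≤-trans (bit+ c) (≤-trans
    (p⊂q⇒∣p∣<∣q∣ (p∩q⊆q U S , i , i∈S , λ i∈ → i∉U (proj₁ (x∈p∩q⁻ U S i∈)))) (≤-reflexive (basis-size bS)))
    where
    bit+ : ∀ c → bit c + ∣ U ∩ S ∣ ≤ suc ∣ U ∩ S ∣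
    bit+ false = n≤1+n _
    bit+ true  = ≤-refl

  tip-absent : ∀ U {c} → IsBasis N S → c ≢ true → bit c + ∣ U ∩ S ∣ ≤ r N full
  tip-absent U {false} bS _   = ≤-trans (∣p∩q∣≤∣q∣ U S) (≤-reflexive (basis-size bS))
  tip-absent U {true}  bS c≢t = contradiction refl c≢t

theorem4p7 : (𝓜 : Class) → Natural 𝓜 →
    ∀ {l m} (L : Matroid l) (N : Matroid m) (p q : Fin l) (A : Subset m) →
    p ≢ q →
    IsBasis N A → IsBasis N (∁ A) →
    ExcludedMinor 𝓜 L →
    IncomparablePair L p q →
    Σ (Matroid l) (λ K → Redirected L p q K × 𝓜 K) →
    Σ (Matroid l) (λ K → Redirected L q p K × 𝓜 K) →
    𝓜 N →
    ∀ {k} (M : Matroid k) → IsM L p q N A M →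
    ∀ {j} (K : Matroid j) → IsProperMinor M K → 𝓜 K
theorem4p7 𝓜 nat {l} {m} L N p q A p≢q bA bB (_ , minors) _ (Kpq , pq , Kpq∈) (Kqp , qp , Kqp∈) N∈ M isM K
  (C , D , f , V , e , e∈) = go (relabel e) (position (relabel e)) e∈' (proj₂ (MinorVia.f-avoid isDel e))
  where
  open IsM isM
  C' D' : Subset (m + (2 + (m + l)))
  C' = image relabel C
  D' = deleted p q ∪ image relabel D
  cM₁ : Construction L p q N A M₁
  cM₁ = record { sum = sum ; addA = addA ; addB = addB ; copies = copies }
  -- The argument takes place in `M₁`, with `deleted p q` part of the deleted set. As `relabel e`
  -- avoids `deleted p q`, it is a copy, `a`, `b`, or an element of `L` other than `p` and `q`.
  V' : MinorVia M₁ K C' D' (relabel ∘ f)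
  V' = minorVia-∘ isDel V
  e∈' : relabel e ∈ C' ⊎ relabel e ∈ D'
  e∈' = [ inj₁ ∘ ∈-image⁺ relabel , inj₂ ∘ q⊆p∪q (deleted p q) _ ∘ ∈-image⁺ relabel ]′ e∈
  go : ∀ e' → Position e' → e' ∈ C' ⊎ e' ∈ D' → e' ∉ deleted p q → 𝓜 K
  go e' pos e'∈ e'∉del = case pos
    where
    sideA' = sideA nat L N p q A bA bB N∈ cM₁ V' (p⊆p∪q _) {e'} e'∈ p≢q pq qp Kpq∈ Kqp∈
    sideB' = sideB nat L N p q A bA bB N∈ cM₁ V' (p⊆p∪q _) {e'} e'∈ p≢q pq qp Kpq∈ Kqp∈
    case : Position e' → 𝓜 K
    case (copy i) with i ∈? A
    ... | yes i∈A = sideA' (λ U b a X i∈ → copy-present U a i∈A (∈-++⁻ˡ i i∈))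
                           (λ U b a X i∉ → copy-absent N U a bA i∈A (i∉ ∘ ∈-++⁺ˡ))
    ... | no i∉A  = sideB' (λ U b a X i∈ → copy-present U b (x∉p⇒x∈∁p i∉A) (∈-++⁻ˡ i i∈))
                           (λ U b a X i∉ → copy-absent N U b bB (x∉p⇒x∈∁p i∉A) (i∉ ∘ ∈-++⁺ˡ))
    case at-a = sideA' (λ U b a X a∈ → present (∈-++⁻ʳ U a∈))
                       (λ U b a X a∉ → tip-absent N U bA (λ { refl → a∉ (∈-++⁺ʳ U (there here)) }))
      where
      present : ∀ {b a n} {X : Subset (m + l)} → pos2a {m} {l} ∈ b ∷ a ∷ X → 1 ≤ bit a + n
      present (there here) = s≤s z≤n
    case at-b = sideB' (λ U b a X b∈ → present (∈-++⁻ʳ U b∈))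
                       (λ U b a X b∉ → tip-absent N U bB (λ { refl → b∉ (∈-++⁺ʳ U here) }))
      where
      present : ∀ {b a n} {X : Subset (m + l)} → pos2b {m} {l} ∈ b ∷ a ∷ X → 1 ≤ bit b + n
      present here = s≤s z≤n
    case (at-N i) = ⊥-elim (e'∉del (N∈deleted i))
    case (at-L u) = element-of-L nat L N p q A bA bB N∈ cM₁ V' (p⊆p∪q _) e'∈ minors u refl
      (λ { refl → e'∉del p∈deleted }) (λ { refl → e'∉del q∈deleted })
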